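{- For every $d \in \mathbb{N}$ and every $\varepsilon > \sqrt{d}/\binom{d+1}{2}$, there is an $\varepsilon$-almost regular $d$-simplex which is not diameter-Ramsey.
   Context: $\mathbb{N}$ denotes the positive integers and $\|\cdot\|$ the Euclidean norm. The diameter of a set $P \subset \mathbb{R}^d$ is $\mathrm{diam}(P) := \sup\{\|x-y\| : x,y \in P\}$. A $d$-simplex is identified with its vertex set, i.e. it is a set $A = \{p_1,\ldots,p_{d+1}\} \subset \mathbb{R}^d$ of $d+1$ affinely independent points. It is called $\varepsilon$-almost regular if $$\frac{1}{\binom{d+1}{2}} \sum_{1 \le i < j \le d+1} \left( \mathrm{diam}(A)^2 - \|p_i - p_j\|^2 \right) \le \varepsilon \cdot \mathrm{diam}(A)^2 .$$ Two sets, possibly in Euclidean spaces of different dimensions, are congruent if there is a distance-preserving bijection between them. A finite set $A \subset \mathbb{R}^d$ is called diameter-Ramsey if for every $r \in \mathbb{N}$ there exist $n \in \mathbb{N}$ and a finite set $B \subset \mathbb{R}^n$ with $\mathrm{diam}(B) = \mathrm{diam}(A)$ such that whenever the points of $B$ are coloured with $r$ colours, there is a monochromatic set $A' \subset B$ (all points of $A'$ have the same colour) which is congruent to $A$.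
   Formalization: The formal statement requires d ≥ 2, because for d = 1 the claim is false: every 1-simplex is diameter-Ramsey (colour the r+1 vertices of a regular simplex of the same side length and use the pigeonhole principle). -}

module Defs where

open import Algebra.Bundles using (CommutativeRing)
open import Data.Bool using (if_then_else_)
open import Data.Empty using (⊥-elim)
open import Data.Fin using (Fin; zero; suc; toℕ; inject)
import Data.Fin.Properties as Fin
open import Data.Integer using (+_)
import Data.Integer as ℤ
import Data.Integer.Properties as ℤ
open import Data.Nat using (ℕ; zero; suc; z≤n; s≤s)
import Data.Nat as ℕ
import Data.Nat.Properties as ℕ
open import Data.Nat.Combinatorics using (_C_)
open import Data.Product using (Σ; ∃; ∃₂; Σ-syntax; ∃-syntax; _×_; _,_; proj₁; proj₂)
open import Data.Rational using (ℚ; 0ℚ; 1ℚ; ½; _/_; ↥_; ↧_; ↧ₙ_; toℚᵘ)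
import Data.Rational as ℚ
import Data.Rational.Properties as ℚ
import Data.Rational.Unnormalised as ℚᵘ
import Data.Rational.Unnormalised.Properties as ℚᵘ
open import Data.Rational.Solver using (module +-*-Solver)
open import Data.Sum as Sum using (_⊎_; inj₁; inj₂)
open import Data.Vec.Functional using (Vector)
open import Function.Base using (_∘_)
open import Function.Bundles using (_↣_; _⤖_; Injection; Bijection)
open import Level using (0ℓ)
open import Relation.Binary.PropositionalEquality
  using (_≡_; _≢_; refl; sym; trans; cong; cong₂; subst; subst₂)
open import Relation.Nullary using (Dec; ¬_; does; yes; no)

------------------------------------------------------------------------
-- Auxiliary facts about ℚ

open ℚ.≤-Reasoning
open +-*-Solver using (solve; _:=_; _:+_; _:*_; _:-_; :-_)

module RationalFacts where

  ⊔ˡ : ∀ {m n o} → m ℕ.⊔ n ℕ.≤ o → m ℕ.≤ o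
  ⊔ˡ {m} {n} = ℕ.m⊔n≤o⇒m≤o m n

  ⊔ʳ : ∀ {m n o} → m ℕ.⊔ n ℕ.≤ o → n ℕ.≤ o
  ⊔ʳ {m} {n} = ℕ.m⊔n≤o⇒n≤o m n

  ⊔⁴ : ∀ a b c d {o} → (a ℕ.⊔ b) ℕ.⊔ (c ℕ.⊔ d) ℕ.≤ o →
       a ℕ.≤ o × b ℕ.≤ o × c ℕ.≤ o × d ℕ.≤ o
  ⊔⁴ a b c d h = ⊔ˡ ab , ⊔ʳ {a} ab , ⊔ˡ cd , ⊔ʳ {c} cd
    where
    ab = ⊔ˡ {a ℕ.⊔ b} {c ℕ.⊔ d} h
    cd = ⊔ʳ {a ℕ.⊔ b} {c ℕ.⊔ d} h

  p≤∣p∣ : ∀ p → p ℚ.≤ ℚ.∣ p ∣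
  p≤∣p∣ p with ℚ.≤-total 0ℚ p
  ... | inj₁ 0≤p = ℚ.≤-reflexive (sym (ℚ.0≤p⇒∣p∣≡p 0≤p))
  ... | inj₂ p≤0 = ℚ.≤-trans p≤0 (ℚ.0≤∣p∣ p)

  ∣p-q∣≡∣q-p∣ : ∀ p q → ℚ.∣ p ℚ.- q ∣ ≡ ℚ.∣ q ℚ.- p ∣
  ∣p-q∣≡∣q-p∣ p q = trans (sym (ℚ.∣-p∣≡∣p∣ (p ℚ.- q)))
    (cong ℚ.∣_∣ (solve 2 (λ a b → :- (a :- b) := b :- a) refl p q))

  ∣p-q∣<-intro : ∀ {p q ε} → p ℚ.< q ℚ.+ ε → q ℚ.< p ℚ.+ ε → ℚ.∣ p ℚ.- q ∣ ℚ.< ε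
  ∣p-q∣<-intro {p} {q} {ε} p<q+ε q<p+ε with ℚ.∣p∣≡p∨∣p∣≡-p (p ℚ.- q)
  ... | inj₁ eq = begin-strict
    ℚ.∣ p ℚ.- q ∣      ≡⟨ eq ⟩
    p ℚ.- q            <⟨ ℚ.+-monoˡ-< (ℚ.- q) p<q+ε ⟩
    (q ℚ.+ ε) ℚ.- q    ≡⟨ solve 2 (λ a e → (a :+ e) :- a := e) refl q ε ⟩
    ε ∎
  ... | inj₂ eq = begin-strict
    ℚ.∣ p ℚ.- q ∣      ≡⟨ eq ⟩
    ℚ.- (p ℚ.- q)      ≡⟨ solve 2 (λ a b → :- (a :- b) := b :- a) refl p q ⟩
    q ℚ.- p            <⟨ ℚ.+-monoˡ-< (ℚ.- p) q<p+ε ⟩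
    (p ℚ.+ ε) ℚ.- p    ≡⟨ solve 2 (λ a e → (a :+ e) :- a := e) refl p ε ⟩
    ε ∎

  ∣p-q∣<-elim : ∀ {p q ε} → ℚ.∣ p ℚ.- q ∣ ℚ.< ε → p ℚ.< q ℚ.+ ε
  ∣p-q∣<-elim {p} {q} {ε} h = begin-strict
    p                  ≡⟨ solve 2 (λ a b → a := b :+ (a :- b)) refl p q ⟩
    q ℚ.+ (p ℚ.- q)    <⟨ ℚ.+-monoʳ-< q (ℚ.≤-<-trans (p≤∣p∣ (p ℚ.- q)) h) ⟩
    q ℚ.+ ε ∎

  ε/2+ε/2≡ε : ∀ ε → ½ ℚ.* ε ℚ.+ ½ ℚ.* ε ≡ ε
  ε/2+ε/2≡ε ε = trans (sym (ℚ.*-distribʳ-+ ε ½ ½)) (ℚ.*-identityˡ ε)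

  *-pos : ∀ {p q} → 0ℚ ℚ.< p → 0ℚ ℚ.< q → 0ℚ ℚ.< p ℚ.* q
  *-pos {p} {q} 0<p 0<q = ℚ.positive⁻¹ (p ℚ.* q)
    {{ℚ.pos*pos⇒pos p {{ℚ.positive 0<p}} q {{ℚ.positive 0<q}}}}

  half-pos : ∀ {ε} → 0ℚ ℚ.< ε → 0ℚ ℚ.< ½ ℚ.* ε
  half-pos = *-pos (ℚ.positive⁻¹ ½)

  *-monoˡ-≤ : ∀ {r p q} → 0ℚ ℚ.≤ r → p ℚ.≤ q → r ℚ.* p ℚ.≤ r ℚ.* q
  *-monoˡ-≤ {r} 0≤r = ℚ.*-monoˡ-≤-nonNeg r {{ℚ.nonNegative 0≤r}}

  *-monoʳ-≤ : ∀ {r p q} → 0ℚ ℚ.≤ r → p ℚ.≤ q → p ℚ.* r ℚ.≤ q ℚ.* r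
  *-monoʳ-≤ {r} 0≤r = ℚ.*-monoʳ-≤-nonNeg r {{ℚ.nonNegative 0≤r}}

  ∣p+q∣<ε : ∀ {ε} p q → ℚ.∣ p ∣ ℚ.< ½ ℚ.* ε → ℚ.∣ q ∣ ℚ.< ½ ℚ.* ε → ℚ.∣ p ℚ.+ q ∣ ℚ.< ε
  ∣p+q∣<ε {ε} p q hp hq = begin-strict
    ℚ.∣ p ℚ.+ q ∣            ≤⟨ ℚ.∣p+q∣≤∣p∣+∣q∣ p q ⟩
    ℚ.∣ p ∣ ℚ.+ ℚ.∣ q ∣      <⟨ ℚ.+-mono-< hp hq ⟩
    ½ ℚ.* ε ℚ.+ ½ ℚ.* ε      ≡⟨ ε/2+ε/2≡ε ε ⟩
    ε ∎

  ∣pq-rs∣<ε : ∀ {M K δ} p q r s → 0ℚ ℚ.< M → 0ℚ ℚ.< K →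
              ℚ.∣ p ∣ ℚ.≤ M → ℚ.∣ s ∣ ℚ.≤ K →
              ℚ.∣ q ℚ.- s ∣ ℚ.< δ → ℚ.∣ p ℚ.- r ∣ ℚ.< δ →
              ℚ.∣ p ℚ.* q ℚ.- r ℚ.* s ∣ ℚ.< (M ℚ.+ K) ℚ.* δ
  ∣pq-rs∣<ε {M} {K} {δ} p q r s 0<M 0<K hp hs hqs hpr = begin-strict
    ℚ.∣ p ℚ.* q ℚ.- r ℚ.* s ∣
      ≡⟨ cong ℚ.∣_∣ (solve 4 (λ a b c d → a :* b :- c :* d := a :* (b :- d) :+ d :* (a :- c)) refl p q r s) ⟩
    ℚ.∣ p ℚ.* (q ℚ.- s) ℚ.+ s ℚ.* (p ℚ.- r) ∣
      ≤⟨ ℚ.∣p+q∣≤∣p∣+∣q∣ (p ℚ.* (q ℚ.- s)) (s ℚ.* (p ℚ.- r)) ⟩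
    ℚ.∣ p ℚ.* (q ℚ.- s) ∣ ℚ.+ ℚ.∣ s ℚ.* (p ℚ.- r) ∣
      ≡⟨ cong₂ ℚ._+_ (ℚ.∣p*q∣≡∣p∣*∣q∣ p (q ℚ.- s)) (ℚ.∣p*q∣≡∣p∣*∣q∣ s (p ℚ.- r)) ⟩
    ℚ.∣ p ∣ ℚ.* ℚ.∣ q ℚ.- s ∣ ℚ.+ ℚ.∣ s ∣ ℚ.* ℚ.∣ p ℚ.- r ∣
      ≤⟨ ℚ.+-mono-≤ (*-monoʳ-≤ (ℚ.0≤∣p∣ (q ℚ.- s)) hp) (*-monoʳ-≤ (ℚ.0≤∣p∣ (p ℚ.- r)) hs) ⟩
    M ℚ.* ℚ.∣ q ℚ.- s ∣ ℚ.+ K ℚ.* ℚ.∣ p ℚ.- r ∣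
      <⟨ ℚ.+-mono-< (ℚ.*-monoʳ-<-pos M {{ℚ.positive 0<M}} hqs) (ℚ.*-monoʳ-<-pos K {{ℚ.positive 0<K}} hpr) ⟩
    M ℚ.* δ ℚ.+ K ℚ.* δ
      ≡⟨ sym (ℚ.*-distribʳ-+ δ M K) ⟩
    (M ℚ.+ K) ℚ.* δ ∎

  divide : ∀ {M ε} → 0ℚ ℚ.< M → 0ℚ ℚ.< ε → ∃[ δ ] (0ℚ ℚ.< δ × M ℚ.* δ ≡ ε)
  divide {M} {ε} 0<M 0<ε =
    (ℚ.1/ M) ℚ.* ε ,
    *-pos (ℚ.positive⁻¹ (ℚ.1/ M) {{ℚ.1/pos⇒pos M}}) 0<ε ,
    trans (sym (ℚ.*-assoc M (ℚ.1/ M) ε)) (trans (cong (ℚ._* ε) (ℚ.*-inverseʳ M)) (ℚ.*-identityˡ ε))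
    where instance
      _ = ℚ.positive 0<M
      _ = ℚ.pos⇒nonZero M {{ℚ.positive 0<M}}

  *-estimate : ∀ {M K ε} → 0ℚ ℚ.< M → 0ℚ ℚ.< K → 0ℚ ℚ.< ε →
               ∃[ δ ] (0ℚ ℚ.< δ × ∀ p q r s → ℚ.∣ p ∣ ℚ.≤ M → ℚ.∣ s ∣ ℚ.≤ K →
                 ℚ.∣ q ℚ.- s ∣ ℚ.< δ → ℚ.∣ p ℚ.- r ∣ ℚ.< δ → ℚ.∣ p ℚ.* q ℚ.- r ℚ.* s ∣ ℚ.< ε)
  *-estimate 0<M 0<K 0<ε =
    let δ , 0<δ , eq = divide (ℚ.+-mono-< 0<M 0<K) 0<ε
    in δ , 0<δ , λ p q r s hp hs hqs hpr →
       subst (ℚ.∣ p ℚ.* q ℚ.- r ℚ.* s ∣ ℚ.<_) eq (∣pq-rs∣<ε p q r s 0<M 0<K hp hs hqs hpr)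

open RationalFacts

------------------------------------------------------------------------
-- The real numbers, as Cauchy sequences of rationals up to the
-- equivalence _≈_

record ℝ : Set where
  no-eta-equality
  field
    seq    : ℕ → ℚ
    cauchy : ∀ ε → 0ℚ ℚ.< ε →
             ∃[ N ] ∀ m n → N ℕ.≤ m → N ℕ.≤ n → ℚ.∣ seq m ℚ.- seq n ∣ ℚ.< ε

open ℝ public using (seq)
open ℝ using (cauchy)

infix 4 _≈_ _≤_ _<_

record _≈_ (x y : ℝ) : Set where
  constructor *≈*
  field eventually : ∀ ε → 0ℚ ℚ.< ε → ∃[ N ] ∀ n → N ℕ.≤ n → ℚ.∣ seq x n ℚ.- seq y n ∣ ℚ.< ε

record _≤_ (x y : ℝ) : Set where
  constructor *≤*
  field eventually : ∀ ε → 0ℚ ℚ.< ε → ∃[ N ] ∀ n → N ℕ.≤ n → seq x n ℚ.≤ seq y n ℚ.+ ε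

record _<_ (x y : ℝ) : Set where
  constructor *<*
  field gap : ∃[ ε ] (0ℚ ℚ.< ε × ∃[ N ] ∀ n → N ℕ.≤ n → seq x n ℚ.+ ε ℚ.≤ seq y n)

module CauchyFacts where

  ∣p-p∣<ε : ∀ {p q ε} → p ≡ q → 0ℚ ℚ.< ε → ℚ.∣ p ℚ.- q ∣ ℚ.< ε
  ∣p-p∣<ε {p} refl 0<ε = subst (λ z → ℚ.∣ z ∣ ℚ.< _) (sym (ℚ.+-inverseʳ p)) 0<ε

  pointwise : ∀ {x y} → (∀ n → seq x n ≡ seq y n) → x ≈ y
  pointwise eq = *≈* λ ε 0<ε → 0 , λ n _ → ∣p-p∣<ε (eq n) 0<ε

  ≈-sym : ∀ {x y} → x ≈ y → y ≈ x
  ≈-sym {x} {y} (*≈* h) = *≈* λ ε 0<ε →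
    let N , f = h ε 0<ε
    in N , λ n N≤n → subst (ℚ._< ε) (∣p-q∣≡∣q-p∣ (seq x n) (seq y n)) (f n N≤n)

  ≈-trans : ∀ {x y z} → x ≈ y → y ≈ z → x ≈ z
  ≈-trans {x} {y} {z} (*≈* h) (*≈* k) = *≈* λ ε 0<ε →
    let N , f = h (½ ℚ.* ε) (half-pos 0<ε)
        K , g = k (½ ℚ.* ε) (half-pos 0<ε)
    in N ℕ.⊔ K , λ n le →
       subst (λ t → ℚ.∣ t ∣ ℚ.< ε)
         (solve 3 (λ a b c → (a :- b) :+ (b :- c) := a :- c) refl (seq x n) (seq y n) (seq z n))
         (∣p+q∣<ε (seq x n ℚ.- seq y n) (seq y n ℚ.- seq z n) (f n (⊔ˡ le)) (g n (⊔ʳ {N} le)))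

  bounded : ∀ x → ∃[ M ] (0ℚ ℚ.< M × ∃[ N ] ∀ n → N ℕ.≤ n → ℚ.∣ seq x n ∣ ℚ.≤ M)
  bounded x with cauchy x 1ℚ (ℚ.positive⁻¹ 1ℚ)
  ... | N , f = ℚ.∣ seq x N ∣ ℚ.+ 1ℚ ,
    ℚ.+-mono-≤-< (ℚ.0≤∣p∣ (seq x N)) (ℚ.positive⁻¹ 1ℚ) ,
    N , λ n N≤n → ℚ.<⇒≤ (begin-strict
      ℚ.∣ seq x n ∣
        ≡⟨ cong ℚ.∣_∣ (solve 2 (λ a b → a := b :+ (a :- b)) refl (seq x n) (seq x N)) ⟩
      ℚ.∣ seq x N ℚ.+ (seq x n ℚ.- seq x N) ∣
        ≤⟨ ℚ.∣p+q∣≤∣p∣+∣q∣ (seq x N) (seq x n ℚ.- seq x N) ⟩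
      ℚ.∣ seq x N ∣ ℚ.+ ℚ.∣ seq x n ℚ.- seq x N ∣
        <⟨ ℚ.+-monoʳ-< ℚ.∣ seq x N ∣ (f n N N≤n ℕ.≤-refl) ⟩
      ℚ.∣ seq x N ∣ ℚ.+ 1ℚ ∎)

open CauchyFacts

fromℚ : ℚ → ℝ
seq    (fromℚ q) _ = q
cauchy (fromℚ q) ε 0<ε = 0 , λ _ _ _ _ → ∣p-p∣<ε {q} refl 0<ε

fromℕ : ℕ → ℝ
fromℕ n = fromℚ (+ n / 1)

0ℝ 1ℝ : ℝ
0ℝ = fromℚ 0ℚ
1ℝ = fromℚ 1ℚ

infixl 6 _+_ _-_
infixl 7 _*_ _/ℕ_
infix  8 -_
infix  9 _²

_+_ : ℝ → ℝ → ℝ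
seq (x + y) n = seq x n ℚ.+ seq y n
cauchy (x + y) ε 0<ε with cauchy x (½ ℚ.* ε) (half-pos 0<ε) | cauchy y (½ ℚ.* ε) (half-pos 0<ε)
... | N , f | K , g = N ℕ.⊔ K , λ m n lm ln →
  subst (λ t → ℚ.∣ t ∣ ℚ.< ε)
    (solve 4 (λ a b c d → (a :- b) :+ (c :- d) := (a :+ c) :- (b :+ d)) refl
      (seq x m) (seq x n) (seq y m) (seq y n))
    (∣p+q∣<ε (seq x m ℚ.- seq x n) (seq y m ℚ.- seq y n)
      (f m n (⊔ˡ lm) (⊔ˡ ln))
      (g m n (⊔ʳ lm) (⊔ʳ ln)))

-_ : ℝ → ℝ
seq (- x) n = ℚ.- seq x n
cauchy (- x) ε 0<ε with cauchy x ε 0<ε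
... | N , f = N , λ m n lm ln →
  subst (λ t → ℚ.∣ t ∣ ℚ.< ε)
    (solve 2 (λ a b → b :- a := (:- a) :- (:- b)) refl (seq x m) (seq x n))
    (f n m ln lm)

_*_ : ℝ → ℝ → ℝ
seq (x * y) n = seq x n ℚ.* seq y n
cauchy (x * y) ε 0<ε =
  let M , 0<M , N₁ , f₁ = bounded x
      K , 0<K , N₂ , f₂ = bounded y
      δ , 0<δ , est     = *-estimate 0<M 0<K 0<ε
      N₃ , f₃           = cauchy x δ 0<δ
      N₄ , f₄           = cauchy y δ 0<δ
  in (N₁ ℕ.⊔ N₂) ℕ.⊔ (N₃ ℕ.⊔ N₄) , λ m n lm ln →
     let 1≤m , _   , 3≤m , 4≤m = ⊔⁴ N₁ N₂ N₃ N₄ lm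
         _   , 2≤n , 3≤n , 4≤n = ⊔⁴ N₁ N₂ N₃ N₄ ln
     in est (seq x m) (seq y m) (seq x n) (seq y n)
          (f₁ m 1≤m) (f₂ n 2≤n) (f₄ m n 4≤m 4≤n) (f₃ m n 3≤m 3≤n)

_-_ : ℝ → ℝ → ℝ
x - y = x + (- y)

_² : ℝ → ℝ
x ² = x * x

-- Division by zero is given the junk value 0ℝ.
_/ℕ_ : ℝ → ℕ → ℝ
x /ℕ zero  = 0ℝ
x /ℕ suc k = x * fromℚ (+ 1 / suc k)

module CongruenceFacts where

  +-cong : ∀ {x x′ y y′} → x ≈ x′ → y ≈ y′ → x + y ≈ x′ + y′
  +-cong {x} {x′} {y} {y′} (*≈* h) (*≈* k) = *≈* λ ε 0<ε →
    let N , f = h (½ ℚ.* ε) (half-pos 0<ε)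
        K , g = k (½ ℚ.* ε) (half-pos 0<ε)
    in N ℕ.⊔ K , λ n le →
       subst (λ t → ℚ.∣ t ∣ ℚ.< ε)
         (solve 4 (λ a b c d → (a :- b) :+ (c :- d) := (a :+ c) :- (b :+ d)) refl
           (seq x n) (seq x′ n) (seq y n) (seq y′ n))
         (∣p+q∣<ε (seq x n ℚ.- seq x′ n) (seq y n ℚ.- seq y′ n) (f n (⊔ˡ le)) (g n (⊔ʳ {N} le)))

  -‿cong : ∀ {x y} → x ≈ y → - x ≈ - y
  -‿cong {x} {y} (*≈* h) = *≈* λ ε 0<ε →
    let N , f = h ε 0<ε
    in N , λ n le → subst (ℚ._< ε)
         (trans (∣p-q∣≡∣q-p∣ (seq x n) (seq y n))
           (cong ℚ.∣_∣ (solve 2 (λ a b → b :- a := (:- a) :- (:- b)) refl (seq x n) (seq y n))))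
         (f n le)

  *-cong : ∀ {x x′ y y′} → x ≈ x′ → y ≈ y′ → x * y ≈ x′ * y′
  *-cong {x} {x′} {y} {y′} (*≈* h) (*≈* k) = *≈* λ ε 0<ε →
    let M , 0<M , N₁ , f₁ = bounded x
        K , 0<K , N₂ , f₂ = bounded y′
        δ , 0<δ , est     = *-estimate 0<M 0<K 0<ε
        N₃ , f₃           = h δ 0<δ
        N₄ , f₄           = k δ 0<δ
    in (N₁ ℕ.⊔ N₂) ℕ.⊔ (N₃ ℕ.⊔ N₄) , λ n ln →
       let 1≤n , 2≤n , 3≤n , 4≤n = ⊔⁴ N₁ N₂ N₃ N₄ ln
       in est (seq x n) (seq y n) (seq x′ n) (seq y′ n)
            (f₁ n 1≤n) (f₂ n 2≤n) (f₄ n 4≤n) (f₃ n 3≤n)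

open CongruenceFacts

ℝ-commutativeRing : CommutativeRing 0ℓ 0ℓ
ℝ-commutativeRing = record
  { Carrier = ℝ ; _≈_ = _≈_ ; _+_ = _+_ ; _*_ = _*_ ; -_ = -_ ; 0# = 0ℝ ; 1# = 1ℝ
  ; isCommutativeRing = record
    { isRing = record
      { +-isAbelianGroup = record
        { isGroup = record
          { isMonoid = record
            { isSemigroup = record
              { isMagma = record
                { isEquivalence = record
                  { refl  = pointwise λ _ → refl
                  ; sym   = ≈-sym
                  ; trans = ≈-trans }
                ; ∙-cong = +-cong }
              ; assoc = λ x y z → pointwise
                          λ n → ℚ.+-assoc (seq x n) (seq y n) (seq z n) }
            ; identity =
                (λ x → pointwise λ n → ℚ.+-identityˡ (seq x n)) ,
                (λ x → pointwise λ n → ℚ.+-identityʳ (seq x n)) }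
          ; inverse =
              (λ x → pointwise λ n → ℚ.+-inverseˡ (seq x n)) ,
              (λ x → pointwise λ n → ℚ.+-inverseʳ (seq x n))
          ; ⁻¹-cong = -‿cong }
        ; comm = λ x y → pointwise λ n → ℚ.+-comm (seq x n) (seq y n) }
      ; *-cong = *-cong
      ; *-assoc = λ x y z → pointwise
                    λ n → ℚ.*-assoc (seq x n) (seq y n) (seq z n)
      ; *-identity =
          (λ x → pointwise λ n → ℚ.*-identityˡ (seq x n)) ,
          (λ x → pointwise λ n → ℚ.*-identityʳ (seq x n))
      ; distrib =
          (λ x y z → pointwise
             λ n → ℚ.*-distribˡ-+ (seq x n) (seq y n) (seq z n)) ,
          (λ x y z → pointwise
             λ n → ℚ.*-distribʳ-+ (seq x n) (seq y n) (seq z n)) }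
    ; *-comm = λ x y → pointwise λ n → ℚ.*-comm (seq x n) (seq y n) } }

------------------------------------------------------------------------
-- Square roots

sq : ℚ → ℚ
sq q = q ℚ.* q

-- For 0 ≤ q: the largest j ≤ k with (j / (n + 1))² ≤ q.
sqrtSearch : ℚ → ℕ → ℕ → ℕ
sqrtSearch q n zero    = zero
sqrtSearch q n (suc k) = if does (sq (+ suc k / suc n) ℚ.≤? q) then suc k else sqrtSearch q n k

-- For 0 ≤ q: the largest multiple of 1 / (n + 1) whose square is at most q; the
-- search starts at ∣↥ q∣ + 1, which exceeds √ q.  For q < 0 it is 0ℚ.
sqrtApprox : ℚ → ℕ → ℚ
sqrtApprox q n = + sqrtSearch q n (suc ℤ.∣ ↥ q ∣ ℕ.* suc n) / suc n

module SqrtFacts where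

  u : ℕ → ℚ
  u n = + 1 / suc n

  0≤k/n : ∀ k n → 0ℚ ℚ.≤ + k / suc n
  0≤k/n k n = ℚ.nonNegative⁻¹ (+ k / suc n) {{ℚ.normalize-nonNeg k (suc n)}}

  0<u : ∀ n → 0ℚ ℚ.< u n
  0<u n = ℚ.positive⁻¹ (u n) {{ℚ.normalize-pos 1 (suc n)}}

  [1+k]/n≡k/n+u : ∀ k n → + suc k / suc n ≡ + k / suc n ℚ.+ u n
  [1+k]/n≡k/n+u k n = ℚ.toℚᵘ-injective (ℚᵘ.≃-trans (ℚ.toℚᵘ-fromℚᵘ (ℚᵘ.mkℚᵘ (+ suc k) n))
    (ℚᵘ.≃-trans (ℚᵘ.*≡* eq) (ℚᵘ.≃-sym (ℚᵘ.≃-trans (ℚ.toℚᵘ-homo-+ (+ k / suc n) (u n))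
      (ℚᵘ.+-cong (ℚ.toℚᵘ-fromℚᵘ (ℚᵘ.mkℚᵘ (+ k) n)) (ℚ.toℚᵘ-fromℚᵘ (ℚᵘ.mkℚᵘ (+ 1) n)))))))
    where
    N = + suc n
    eq : + suc k ℤ.* (N ℤ.* N) ≡ (+ k ℤ.* N ℤ.+ + 1 ℤ.* N) ℤ.* N
    eq = trans (sym (ℤ.*-assoc (+ suc k) N N)) (cong (ℤ._* N)
           (trans (cong (ℤ._* N) (ℤ.+-comm (+ 1) (+ k))) (ℤ.*-distribʳ-+ N (+ k) (+ 1))))

  bn/n≡b : ∀ b n → + (b ℕ.* suc n) / suc n ≡ + b / 1
  bn/n≡b b n = ℚ.fromℚᵘ-cong {ℚᵘ.mkℚᵘ (+ (b ℕ.* suc n)) n} {ℚᵘ.mkℚᵘ (+ b) 0}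
    (ℚᵘ.*≡* (trans (ℤ.*-identityʳ (+ (b ℕ.* suc n))) (ℤ.pos-* b (suc n))))

  i≤+∣i∣ : ∀ i → i ℤ.≤ + ℤ.∣ i ∣
  i≤+∣i∣ (+ n)      = ℤ.≤-refl
  i≤+∣i∣ ℤ.-[1+ n ] = ℤ.-≤+

  q≤∣↥q∣ : ∀ q → q ℚ.≤ + ℤ.∣ ↥ q ∣ / 1
  q≤∣↥q∣ q@record{} = ℚ.toℚᵘ-cancel-≤
    (ℚᵘ.≤-respʳ-≃ (ℚᵘ.≃-sym (ℚ.toℚᵘ-fromℚᵘ (ℚᵘ.mkℚᵘ (+ ℤ.∣ ↥ q ∣) 0)))
    (ℚᵘ.*≤* (ℤ.≤-trans (ℤ.*-monoʳ-≤-nonNeg (+ 1) (i≤+∣i∣ (↥ q)))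
      (ℤ.*-monoˡ-≤-nonNeg (+ ℤ.∣ ↥ q ∣) (ℤ.+≤+ (s≤s z≤n))))))

  k<[1+k] : ∀ k → + k / 1 ℚ.< + suc k / 1
  k<[1+k] k = subst (+ k / 1 ℚ.<_) (sym ([1+k]/n≡k/n+u k 0))
    (subst (ℚ._< + k / 1 ℚ.+ 1ℚ) (ℚ.+-identityʳ (+ k / 1)) (ℚ.+-monoʳ-< (+ k / 1) (ℚ.positive⁻¹ 1ℚ)))

  1≤[1+k] : ∀ k → 1ℚ ℚ.≤ + suc k / 1
  1≤[1+k] k = subst₂ ℚ._≤_ (ℚ.+-identityˡ 1ℚ) (sym ([1+k]/n≡k/n+u k 0)) (ℚ.+-monoˡ-≤ 1ℚ (0≤k/n k 0))

  sq-mono-≤ : ∀ {p q} → 0ℚ ℚ.≤ p → p ℚ.≤ q → sq p ℚ.≤ sq q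
  sq-mono-≤ 0≤p p≤q = ℚ.≤-trans (*-monoˡ-≤ 0≤p p≤q) (*-monoʳ-≤ (ℚ.≤-trans 0≤p p≤q) p≤q)

  p≤p+r : ∀ {p r} → 0ℚ ℚ.≤ r → p ℚ.≤ p ℚ.+ r
  p≤p+r {p} {r} h = subst (ℚ._≤ p ℚ.+ r) (ℚ.+-identityʳ p) (ℚ.+-monoʳ-≤ p h)

  if-elim : ∀ {P : Set} (Q : ℕ → Set) (P? : Dec P) {j k} →
            (P → Q j) → (¬ P → Q k) → Q (if does P? then j else k)
  if-elim Q (yes p) f g = f p
  if-elim Q (no ¬p) f g = g ¬p

  sqrtSearch-lower : ∀ q n k → sqrtSearch q n k ≡ 0 ⊎ sq (+ sqrtSearch q n k / suc n) ℚ.≤ q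
  sqrtSearch-lower q n zero    = inj₁ refl
  sqrtSearch-lower q n (suc k) = if-elim (λ j → j ≡ 0 ⊎ sq (+ j / suc n) ℚ.≤ q)
    (sq (+ suc k / suc n) ℚ.≤? q) inj₂ (λ _ → sqrtSearch-lower q n k)

  sqrtSearch-upper : ∀ q n k → q ℚ.< sq (+ suc k / suc n) → q ℚ.< sq (+ suc (sqrtSearch q n k) / suc n)
  sqrtSearch-upper q n zero    h = h
  sqrtSearch-upper q n (suc k) h = if-elim (λ j → q ℚ.< sq (+ suc j / suc n))
    (sq (+ suc k / suc n) ℚ.≤? q) (λ _ → h) (λ ≰q → sqrtSearch-upper q n k (ℚ.≰⇒> ≰q))

  0≤sqrtApprox : ∀ q n → 0ℚ ℚ.≤ sqrtApprox q n
  0≤sqrtApprox q n = 0≤k/n (sqrtSearch q n (suc ℤ.∣ ↥ q ∣ ℕ.* suc n)) n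

  sqrtApprox-lower : ∀ q n → sqrtApprox q n ≡ 0ℚ ⊎ sq (sqrtApprox q n) ℚ.≤ q
  sqrtApprox-lower q n = Sum.map₁ (λ eq → trans (cong (λ k → + k / suc n) eq) (ℚ.0/n≡0 (suc n)))
    (sqrtSearch-lower q n (suc ℤ.∣ ↥ q ∣ ℕ.* suc n))

  sqrtApprox-upper : ∀ q n → q ℚ.< sq (sqrtApprox q n ℚ.+ u n)
  sqrtApprox-upper q n =
    subst (λ t → q ℚ.< sq t) ([1+k]/n≡k/n+u (sqrtSearch q n b) n) (sqrtSearch-upper q n b q<)
    where
    a = ℤ.∣ ↥ q ∣
    b = suc a ℕ.* suc n
    c = + suc a / 1
    q< : q ℚ.< sq (+ suc b / suc n)
    q< = begin-strict
      q                        ≤⟨ q≤∣↥q∣ q ⟩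
      + a / 1                  <⟨ k<[1+k] a ⟩
      c                        ≡⟨ sym (ℚ.*-identityˡ c) ⟩
      1ℚ ℚ.* c                 ≤⟨ *-monoʳ-≤ (0≤k/n (suc a) 0) (1≤[1+k] a) ⟩
      sq c                     ≡⟨ cong sq (sym (bn/n≡b (suc a) n)) ⟩
      sq (+ b / suc n)         ≤⟨ sq-mono-≤ (0≤k/n b n) (p≤p+r (ℚ.<⇒≤ (0<u n))) ⟩
      sq (+ b / suc n ℚ.+ u n) ≡⟨ cong sq (sym ([1+k]/n≡k/n+u b n)) ⟩
      sq (+ suc b / suc n) ∎

  u-small : ∀ ε → 0ℚ ℚ.< ε → ∃[ N ] ∀ n → N ℕ.≤ n → u n ℚ.≤ ε
  u-small ε@(ℚ.mkℚ (+ suc i) d _) 0<ε = d , λ n d≤n →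
    ℚ.toℚᵘ-cancel-≤ (ℚᵘ.≤-respˡ-≃ (ℚᵘ.≃-sym (ℚ.toℚᵘ-fromℚᵘ (ℚᵘ.mkℚᵘ (+ 1) n)))
      (ℚᵘ.*≤* (ℤ.+≤+ (ℕ.*-mono-≤ {1} {suc i} (s≤s z≤n) (s≤s d≤n)))))
  u-small (ℚ.mkℚ (+ 0) d _) (ℚ.*<* (ℤ.+<+ ()))
  u-small (ℚ.mkℚ ℤ.-[1+ i ] d _) (ℚ.*<* ())

  root-close : ∀ {ε δ v p q s t} → 0ℚ ℚ.< δ → δ ℚ.+ δ ≡ ε → 0ℚ ℚ.≤ v → v ℚ.≤ δ →
               0ℚ ℚ.≤ t → q ℚ.< sq (t ℚ.+ v) → s ≡ 0ℚ ⊎ sq s ℚ.≤ p →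
               ℚ.∣ p ℚ.- q ∣ ℚ.< sq δ → s ℚ.< t ℚ.+ ε
  root-close {ε} {δ} {v} {p} {q} {s} {t} 0<δ eq 0≤v v≤δ 0≤t q< s-lower close = ℚ.≰⇒> λ t+ε≤s →
    ℚ.<-irrefl refl (ℚ.<-≤-trans p< (ℚ.≤-trans (chain t+ε≤s) (s²≤p t+ε≤s)))
    where
    0≤δ = ℚ.<⇒≤ 0<δ
    0<ε : 0ℚ ℚ.< ε
    0<ε = subst (0ℚ ℚ.<_) eq (ℚ.+-mono-< 0<δ 0<δ)
    s²≤p : t ℚ.+ ε ℚ.≤ s → sq s ℚ.≤ p
    s²≤p t+ε≤s = Sum.[ (λ s≡0 → ⊥-elim (ℚ.<-irrefl refl
      (ℚ.<-≤-trans (ℚ.+-mono-≤-< 0≤t 0<ε) (ℚ.≤-trans t+ε≤s (ℚ.≤-reflexive s≡0))))) , (λ h → h) ]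
      s-lower
    p< : p ℚ.< sq (t ℚ.+ δ) ℚ.+ sq δ
    p< = begin-strict
      p                        <⟨ ∣p-q∣<-elim close ⟩
      q ℚ.+ sq δ               <⟨ ℚ.+-monoˡ-< (sq δ) q< ⟩
      sq (t ℚ.+ v) ℚ.+ sq δ    ≤⟨ ℚ.+-monoˡ-≤ (sq δ)
                                    (sq-mono-≤ (ℚ.+-mono-≤ 0≤t 0≤v) (ℚ.+-monoʳ-≤ t v≤δ)) ⟩
      sq (t ℚ.+ δ) ℚ.+ sq δ ∎
    0≤[t+δ]δ : 0ℚ ℚ.≤ (t ℚ.+ δ) ℚ.* δ
    0≤[t+δ]δ = subst (ℚ._≤ (t ℚ.+ δ) ℚ.* δ) (ℚ.*-zeroˡ δ) (*-monoʳ-≤ {δ} {0ℚ} {t ℚ.+ δ} 0≤δ (ℚ.+-mono-≤ 0≤t 0≤δ))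
    chain : t ℚ.+ ε ℚ.≤ s → sq (t ℚ.+ δ) ℚ.+ sq δ ℚ.≤ sq s
    chain t+ε≤s = begin
      sq (t ℚ.+ δ) ℚ.+ sq δ
        ≤⟨ p≤p+r (ℚ.+-mono-≤ 0≤[t+δ]δ 0≤[t+δ]δ) ⟩
      (sq (t ℚ.+ δ) ℚ.+ sq δ) ℚ.+ ((t ℚ.+ δ) ℚ.* δ ℚ.+ (t ℚ.+ δ) ℚ.* δ)
        ≡⟨ solve 2 (λ x y → ((x :+ y) :* (x :+ y) :+ y :* y) :+ ((x :+ y) :* y :+ (x :+ y) :* y)
                      := (x :+ (y :+ y)) :* (x :+ (y :+ y))) refl t δ ⟩
      sq (t ℚ.+ (δ ℚ.+ δ))
        ≡⟨ cong (λ z → sq (t ℚ.+ z)) eq ⟩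
      sq (t ℚ.+ ε)
        ≤⟨ sq-mono-≤ (ℚ.+-mono-≤ 0≤t (ℚ.<⇒≤ 0<ε)) t+ε≤s ⟩
      sq s ∎

  sqrtApprox-close : ∀ {ε} p q m n → 0ℚ ℚ.< ε → u n ℚ.≤ ½ ℚ.* ε →
                     ℚ.∣ p ℚ.- q ∣ ℚ.< sq (½ ℚ.* ε) → sqrtApprox p m ℚ.< sqrtApprox q n ℚ.+ ε
  sqrtApprox-close {ε} p q m n 0<ε u≤ close =
    root-close (half-pos 0<ε) (ε/2+ε/2≡ε ε) (ℚ.<⇒≤ (0<u n)) u≤
      (0≤sqrtApprox q n) (sqrtApprox-upper q n) (sqrtApprox-lower p m) close

  root-sq< : ∀ {ε q s} → 0ℚ ℚ.< ε → s ≡ 0ℚ ⊎ sq s ℚ.≤ q → 0ℚ ℚ.≤ q ℚ.+ ½ ℚ.* ε → sq s ℚ.< q ℚ.+ ε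
  root-sq< {ε} {q} {s} 0<ε (inj₂ s²≤q) _ = ℚ.≤-<-trans s²≤q
    (subst (ℚ._< q ℚ.+ ε) (ℚ.+-identityʳ q) (ℚ.+-monoʳ-< q 0<ε))
  root-sq< {ε} {q} {s} 0<ε (inj₁ s≡0) h = begin-strict
    sq s                               ≡⟨ trans (cong sq s≡0) (ℚ.*-zeroˡ 0ℚ) ⟩
    0ℚ                                 ≤⟨ h ⟩
    q ℚ.+ ½ ℚ.* ε                      ≡⟨ sym (ℚ.+-identityʳ (q ℚ.+ ½ ℚ.* ε)) ⟩
    (q ℚ.+ ½ ℚ.* ε) ℚ.+ 0ℚ             <⟨ ℚ.+-monoʳ-< (q ℚ.+ ½ ℚ.* ε) (half-pos 0<ε) ⟩
    (q ℚ.+ ½ ℚ.* ε) ℚ.+ ½ ℚ.* ε        ≡⟨ ℚ.+-assoc q (½ ℚ.* ε) (½ ℚ.* ε) ⟩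
    q ℚ.+ (½ ℚ.* ε ℚ.+ ½ ℚ.* ε)        ≡⟨ cong (q ℚ.+_) (ε/2+ε/2≡ε ε) ⟩
    q ℚ.+ ε ∎

  <root-sq : ∀ {M δ ε v q s} → 0ℚ ℚ.< M → (M ℚ.+ M ℚ.+ 1ℚ) ℚ.* δ ≡ ε → ℚ.∣ s ∣ ℚ.≤ M →
             0ℚ ℚ.≤ v → v ℚ.≤ δ → v ℚ.≤ 1ℚ → q ℚ.< sq (s ℚ.+ v) → q ℚ.< sq s ℚ.+ ε
  <root-sq {M} {δ} {ε} {v} {q} {s} 0<M eq s≤M 0≤v v≤δ v≤1 q< = begin-strict
    q
      <⟨ q< ⟩
    sq (s ℚ.+ v)
      ≡⟨ solve 2 (λ a b → (a :+ b) :* (a :+ b) := a :* a :+ (a :+ a :+ b) :* b) refl s v ⟩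
    sq s ℚ.+ (s ℚ.+ s ℚ.+ v) ℚ.* v
      ≤⟨ ℚ.+-monoʳ-≤ (sq s) (*-monoʳ-≤ {v} 0≤v (ℚ.+-mono-≤ (ℚ.+-mono-≤ s≤ s≤) v≤1)) ⟩
    sq s ℚ.+ (M ℚ.+ M ℚ.+ 1ℚ) ℚ.* v
      ≤⟨ ℚ.+-monoʳ-≤ (sq s) (*-monoˡ-≤ {M ℚ.+ M ℚ.+ 1ℚ}
           (ℚ.<⇒≤ (ℚ.+-mono-< (ℚ.+-mono-< 0<M 0<M) (ℚ.positive⁻¹ 1ℚ))) v≤δ) ⟩
    sq s ℚ.+ (M ℚ.+ M ℚ.+ 1ℚ) ℚ.* δ
      ≡⟨ cong (sq s ℚ.+_) eq ⟩
    sq s ℚ.+ ε ∎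
    where
    s≤ = ℚ.≤-trans (p≤∣p∣ s) s≤M

open SqrtFacts

-- The square root of a nonnegative real (and 0 on negative reals); see √-nonneg and √-sq.
√_ : ℝ → ℝ
seq (√ x) n = sqrtApprox (seq x n) n
cauchy (√ x) ε 0<ε =
  let δ = ½ ℚ.* ε
      0<δ = half-pos 0<ε
      N , f = cauchy x (sq δ) (*-pos 0<δ 0<δ)
      K , g = u-small δ 0<δ
  in N ℕ.⊔ K , λ m n lm ln →
     ∣p-q∣<-intro
       (sqrtApprox-close (seq x m) (seq x n) m n 0<ε (g n (⊔ʳ {N} ln)) (f m n (⊔ˡ lm) (⊔ˡ ln)))
       (sqrtApprox-close (seq x n) (seq x m) n m 0<ε (g m (⊔ʳ {N} lm)) (f n m (⊔ˡ ln) (⊔ˡ lm)))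

√-nonneg : ∀ x → 0ℝ ≤ √ x
√-nonneg x = *≤* λ ε 0<ε → 0 , λ n _ → ℚ.+-mono-≤ (0≤sqrtApprox (seq x n) n) (ℚ.<⇒≤ 0<ε)

√-sq : ∀ x → 0ℝ ≤ x → (√ x) ² ≈ x
√-sq x (*≤* 0≤x) = *≈* λ ε 0<ε →
  let M , 0<M , N₁ , f₁ = bounded (√ x)
      η                 = ½ ℚ.* ε
      0<η               = half-pos 0<ε
      0<K               = ℚ.+-mono-< (ℚ.+-mono-< 0<M 0<M) (ℚ.positive⁻¹ 1ℚ)
      δ , 0<δ , eq      = divide 0<K 0<ε
      N₂ , f₂           = u-small δ 0<δ
      N₃ , f₃           = u-small 1ℚ (ℚ.positive⁻¹ 1ℚ)
      N₄ , f₄           = 0≤x η 0<η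
  in (N₁ ℕ.⊔ N₂) ℕ.⊔ (N₃ ℕ.⊔ N₄) , λ n le →
     let 1≤ , 2≤ , 3≤ , 4≤ = ⊔⁴ N₁ N₂ N₃ N₄ le
         s     = sqrtApprox (seq x n) n
         s-low = sqrtApprox-lower (seq x n) n
         s-upp = sqrtApprox-upper (seq x n) n
     in ∣p-q∣<-intro {sq s} {seq x n} {ε}
          (root-sq< {ε} {seq x n} {s} 0<ε s-low (f₄ n 4≤))
          (<root-sq {M} {δ} {ε} {u n} {seq x n} {s} 0<M eq (f₁ n 1≤)
            (ℚ.<⇒≤ (0<u n)) (f₂ n 2≤) (f₃ n 3≤) s-upp)

------------------------------------------------------------------------
-- Euclidean space

open import Algebra.Properties.Semiring.Sum (CommutativeRing.semiring ℝ-commutativeRing) public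
  using (sum; sum-syntax)

Point : ℕ → Set
Point n = Vector ℝ n

infix  4 _≈ᵖ_
infixl 6 _-ᵖ_

_≈ᵖ_ : ∀ {n} → Point n → Point n → Set
p ≈ᵖ q = ∀ l → p l ≈ q l

_-ᵖ_ : ∀ {n} → Point n → Point n → Point n
(p -ᵖ q) l = p l - q l

‖_‖ : ∀ {n} → Point n → ℝ
‖_‖ {n} v = √ (∑[ l < n ] (v l ²))

-- A finite subset of ℝⁿ, enumerated without repetition.
record FiniteSet (n : ℕ) : Set where
  field
    size     : ℕ
    point    : Fin size → Point n
    distinct : ∀ i j → point i ≈ᵖ point j → i ≡ j

open FiniteSet public

-- The subset of B enumerated by an injection into the indices of B.
subset : ∀ {n k} (B : FiniteSet n) → Fin k ↣ Fin (size B) → FiniteSet n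
subset {k = k} B g = record
  { size     = k
  ; point    = point B ∘ Injection.to g
  ; distinct = λ i j h → Injection.injective g (distinct B (Injection.to g i) (Injection.to g j) h)
  }

IsSupremum : (ℝ → Set) → ℝ → Set
IsSupremum S s = (∀ t → S t → t ≤ s) × (∀ b → (∀ t → S t → t ≤ b) → s ≤ b)

IsDiameter : ∀ {n} → FiniteSet n → ℝ → Set
IsDiameter A = IsSupremum λ t → ∃₂ λ i j → t ≈ ‖ point A i -ᵖ point A j ‖

Congruent : ∀ {m n} → FiniteSet m → FiniteSet n → Set
Congruent A A′ = Σ[ f ∈ Fin (size A) ⤖ Fin (size A′) ]
  (∀ i j → ‖ point A i -ᵖ point A j ‖ ≈ ‖ point A′ (Bijection.to f i) -ᵖ point A′ (Bijection.to f j) ‖)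

-- The points of B are distinct, so colouring them is colouring their indices.  The monochromatic
-- subset A′ is given by the injection g, as subset B g.
DiameterRamsey : ∀ {d} → FiniteSet d → Set
DiameterRamsey A =
  ∀ r → 1 ℕ.≤ r →
  ∃[ n ] 1 ℕ.≤ n × Σ[ B ∈ FiniteSet n ]
    (∃[ D ] IsDiameter A D × IsDiameter B D) ×
    (∀ (χ : Fin (size B) → Fin r) →
      ∃[ k ] Σ[ g ∈ Fin k ↣ Fin (size B) ]
        (∀ i j → χ (Injection.to g i) ≡ χ (Injection.to g j)) × Congruent A (subset B g))

------------------------------------------------------------------------
-- Simplices

AffinelyIndependent : ∀ {n k} → (Fin k → Point n) → Set
AffinelyIndependent {k = k} p =
  ∀ (c : Fin k → ℝ) → ∑[ i < k ] c i ≈ 0ℝ → (∀ l → ∑[ i < k ] (c i * p i l) ≈ 0ℝ) → ∀ i → c i ≈ 0ℝ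

record Simplex (d : ℕ) : Set where
  field
    vertex              : Fin (suc d) → Point d
    affinelyIndependent : AffinelyIndependent vertex

module Distinctness where
  open CommutativeRing ℝ-commutativeRing
    using (setoid; semiring; ring; +-commutativeMonoid; *-assoc; *-comm; *-identityˡ; *-identityʳ;
           +-identityʳ; zeroˡ; zeroʳ; -‿inverseʳ; distribʳ; +-congʳ; +-congˡ; *-congˡ; *-congʳ)
    renaming (refl to ≈-refl)
  open import Algebra.Properties.Semiring.Sum semiring
    using (∑-distrib-+; sum-cong-≋; sum-replicate-zero; *-distribˡ-sum)
  open import Algebra.Properties.Ring ring using (-1*x≈-x)
  import Relation.Binary.Reasoning.Setoid setoid as ≈-Reasoning

  δ : ∀ {k} → Fin k → Fin k → ℝ
  δ zero    zero    = 1ℝ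
  δ zero    (suc j) = 0ℝ
  δ (suc i) zero    = 0ℝ
  δ (suc i) (suc j) = δ i j

  δ-diag : ∀ {k} (i : Fin k) → δ i i ≡ 1ℝ
  δ-diag zero    = refl
  δ-diag (suc i) = δ-diag i

  δ-off : ∀ {k} (i j : Fin k) → i ≢ j → δ i j ≡ 0ℝ
  δ-off zero    zero    i≢j = ⊥-elim (i≢j refl)
  δ-off zero    (suc j) i≢j = refl
  δ-off (suc i) zero    i≢j = refl
  δ-off (suc i) (suc j) i≢j = δ-off i j (i≢j ∘ cong suc)

  ∑δ : ∀ {k} (i : Fin k) (f : Fin k → ℝ) → ∑[ l < k ] (δ i l * f l) ≈ f i
  ∑δ {suc k} zero f = ≈-trans (+-cong (*-identityˡ (f zero))
    (≈-trans (sum-cong-≋ {k} λ l → zeroˡ (f (suc l))) (sum-replicate-zero k))) (+-identityʳ (f zero))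
  ∑δ {suc k} (suc i) f = ≈-trans (+-cong (zeroˡ (f zero)) (∑δ i (f ∘ suc)))
    (CommutativeRing.+-identityˡ ℝ-commutativeRing (f (suc i)))

  diff : ∀ {k} → Fin k → Fin k → Fin k → ℝ
  diff i j l = δ i l + (- 1ℝ) * δ j l

  ∑diff : ∀ {k} (i j : Fin k) (f : Fin k → ℝ) → ∑[ l < k ] (diff i j l * f l) ≈ f i - f j
  ∑diff {k} i j f = ≈-begin
    ∑[ l < k ] (diff i j l * f l)
      ≈⟨ sum-cong-≋ {k} (λ l → ≈-trans (distribʳ (f l) (δ i l) ((- 1ℝ) * δ j l))
           (+-congˡ {δ i l * f l} (*-assoc (- 1ℝ) (δ j l) (f l)))) ⟩
    ∑[ l < k ] (δ i l * f l + (- 1ℝ) * (δ j l * f l))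
      ≈⟨ ∑-distrib-+ {k} (λ l → δ i l * f l) (λ l → (- 1ℝ) * (δ j l * f l)) ⟩
    ∑[ l < k ] (δ i l * f l) + ∑[ l < k ] ((- 1ℝ) * (δ j l * f l))
      ≈⟨ +-cong (∑δ i f) (≈-sym (*-distribˡ-sum {k} (- 1ℝ) (λ l → δ j l * f l))) ⟩
    f i + (- 1ℝ) * ∑[ l < k ] (δ j l * f l)
      ≈⟨ +-congˡ {f i} (≈-trans (*-congˡ { - 1ℝ} (∑δ j f)) (-1*x≈-x (f j))) ⟩
    f i - f j ≈-∎
    where open ≈-Reasoning renaming (begin_ to ≈-begin_; _∎ to _≈-∎)

  1≉0 : ¬ (1ℝ ≈ 0ℝ)
  1≉0 (*≈* h) with h ½ (ℚ.positive⁻¹ ½)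
  ... | N , f with f N ℕ.≤-refl
  ... | ℚ.*<* (ℤ.+<+ (s≤s ()))

  diff≈1 : ∀ {k} (i j : Fin k) → i ≢ j → diff i j i ≈ 1ℝ
  diff≈1 i j i≢j = subst₂ (λ a b → a + (- 1ℝ) * b ≈ 1ℝ)
    (sym (δ-diag i)) (sym (δ-off j i (i≢j ∘ sym)))
    (≈-trans (+-congˡ {1ℝ} (zeroʳ (- 1ℝ))) (+-identityʳ 1ℝ))

  x≈y⇒x-y≈0 : ∀ {x y} → x ≈ y → x - y ≈ 0ℝ
  x≈y⇒x-y≈0 {x} {y} h = ≈-trans (+-congʳ { - y} h) (-‿inverseʳ y)

  vertices-distinct : ∀ {n k} (p : Fin k → Point n) → AffinelyIndependent p →
                      ∀ i j → p i ≈ᵖ p j → i ≡ j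
  vertices-distinct {n} {k} p ind i j h with i Fin.≟ j
  ... | yes eq  = eq
  ... | no  i≢j = ⊥-elim (1≉0 (≈-trans (≈-sym (diff≈1 i j i≢j)) (ind (diff i j) ∑c (λ l →
          ≈-trans (∑diff i j (λ m → p m l)) (x≈y⇒x-y≈0 (h l))) i)))
    where
    ∑c : ∑[ l < k ] diff i j l ≈ 0ℝ
    ∑c = ≈-trans (sum-cong-≋ {k} (λ l → ≈-sym (*-identityʳ (diff i j l))))
           (≈-trans (∑diff i j (λ _ → 1ℝ)) (-‿inverseʳ 1ℝ))

vertexSet : ∀ {d} → Simplex d → FiniteSet d
vertexSet {d} A = record
  { size     = suc d
  ; point    = Simplex.vertex A
  ; distinct = Distinctness.vertices-distinct (Simplex.vertex A) (Simplex.affinelyIndependent A)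
  }

-- The sum of f i j over all i < j.
∑-pairs : ∀ k → (Fin k → Fin k → ℝ) → ℝ
∑-pairs k f = ∑[ j < k ] ∑[ i < toℕ j ] f (inject i) j

AlmostRegular : ∀ {d} → ℝ → Simplex d → Set
AlmostRegular {d} ε A = ∃[ D ] IsDiameter (vertexSet A) D ×
  ∑-pairs (suc d) (λ i j → D ² - ‖ vertex i -ᵖ vertex j ‖ ²) /ℕ (suc d C 2) ≤ ε * D ²
  where open Simplex A

{-# OPTIONS --safe #-}

-- The simplex has d vertices at mutual distance D and an apex on the line through their centroid, at
-- such a height that u = ∑ (1 - ‖pᵢ - pⱼ‖² / D²) slightly exceeds √d; it is then ε-almost regular, and
-- its circumradius slightly exceeds D / √2.  By Jung's theorem a finite set B of diameter D lies in a
-- ball of radius D / √2.  Colouring the points of B by their distance from the centre of that ball,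
-- in thin shells, a monochromatic copy of the simplex would almost lie on a sphere of radius at
-- most D / √2, which the circumradius forbids.  Everything is scaled to D = √2.

module Submission where

open import Defs
open import Algebra.Bundles using (CommutativeRing)
import Algebra.Solver.Ring
open import Algebra.Solver.Ring.AlmostCommutativeRing
  using (AlmostCommutativeRing; fromCommutativeRing; _-Raw-AlmostCommutative⟶_; Induced-equivalence)
open import Data.Empty using (⊥; ⊥-elim)
open import Data.Fin using (Fin; zero; suc; fromℕ<; inject; toℕ)
import Data.Fin.Properties as Fin
open import Data.Integer using (+_)
import Data.Integer as ℤ
open import Data.Maybe using (just; nothing)
open import Data.Nat using (ℕ; zero; suc)
import Data.Nat as ℕ
open import Data.Nat.Combinatorics using (_C_)
import Data.Nat.Properties as ℕ
open import Data.Product using (Σ-syntax; ∃-syntax; _×_; _,_; proj₁; proj₂)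
open import Data.Rational using (ℚ; 0ℚ; 1ℚ; ½; _/_)
import Data.Rational as ℚ
import Data.Rational.Properties as ℚ
import Data.Rational.Solver
open import Data.Sum using (_⊎_; inj₁; inj₂; swap)
open import Function.Base using (_∘_)
open import Function.Bundles using (_↣_; Injection; Bijection)
open import Relation.Binary.Definitions using (WeaklyDecidable)
open import Relation.Binary.PropositionalEquality as ≡ using (_≡_; _≢_; cong; subst; subst₂)
open import Relation.Nullary using (¬_; yes; no)

open RationalFacts
open CauchyFacts
open CongruenceFacts
open SqrtFacts
open Distinctness using (δ; δ-diag; δ-off; ∑δ; diff; ∑diff)
open CommutativeRing ℝ-commutativeRing
  using (semiring; +-congˡ; +-congʳ; *-congˡ; *-congʳ; zeroˡ; zeroʳ; *-identityˡ; +-identityʳ; *-assoc)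
  renaming (refl to ≈-refl)
open import Algebra.Properties.Semiring.Sum semiring
  using (∑-distrib-+; ∑-comm; sum-cong-≋; *-distribˡ-sum)

-- With D = √2 each apex edge has squared length 2 - 2u/d, and the circumradius satisfies R² = (d -
-- u)² / (d (d + 1 - 2u)). Since (d - u)² - d (d + 1 - 2u) = u² - d, it exceeds 1 exactly when u >
-- √d: this is where the bound on ε comes from.
--
-- As u > 1, the circumcentre lies beyond the base and the apex has a negative barycentric weight.
-- Upper bounds on distances may therefore be used at the base vertices only, and the apex serves as
-- the point of reference.
--
-- The number of colours has to be fixed before B is known, so the thickness θ of the shells depends
-- on d and u alone.
--
-- The order of the Cauchy reals is undecidable, so neither an exact smallest ball nor an exact
-- partition into shells is at hand. A ball of squared radius 1 + 2θ and overlapping shells of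
-- squared distances replace them. Both errors are proportional to θ, and the fixed gap u² - d
-- absorbs them.

ℝ-ring : AlmostCommutativeRing _ _
ℝ-ring = fromCommutativeRing ℝ-commutativeRing

fromℚ-morphism : CommutativeRing.rawRing ℚ.+-*-commutativeRing -Raw-AlmostCommutative⟶ ℝ-ring
fromℚ-morphism = record
  { ⟦_⟧    = fromℚ
  ; +-homo = λ _ _ → pointwise λ _ → ≡.refl
  ; *-homo = λ _ _ → pointwise λ _ → ≡.refl
  ; -‿homo = λ _ → pointwise λ _ → ≡.refl
  ; 0-homo = ≈-refl
  ; 1-homo = ≈-refl
  }

fromℚ-≟ : WeaklyDecidable (Induced-equivalence fromℚ-morphism)
fromℚ-≟ p q with p ℚ.≟ q
... | yes ≡.refl = just ≈-refl
... | no _       = nothing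

-- Coefficients are rational, so identities with constants such as 5/4 and 1/64 are within reach of
-- the solver.
module ℝ-Solver = Algebra.Solver.Ring
  (CommutativeRing.rawRing ℚ.+-*-commutativeRing) ℝ-ring fromℚ-morphism fromℚ-≟
module ℚ-Solver = Data.Rational.Solver.+-*-Solver

-- The ordered ring ℝ

half-half : ∀ p ε → (p ℚ.+ ½ ℚ.* ε) ℚ.+ ½ ℚ.* ε ≡ p ℚ.+ ε
half-half p ε = ≡.trans (ℚ.+-assoc p (½ ℚ.* ε) (½ ℚ.* ε)) (cong (p ℚ.+_) (ε/2+ε/2≡ε ε))

p<p+ε : ∀ p {ε} → 0ℚ ℚ.< ε → p ℚ.< p ℚ.+ ε
p<p+ε p {ε} 0<ε = subst (ℚ._< p ℚ.+ ε) (ℚ.+-identityʳ p) (ℚ.+-monoʳ-< p 0<ε)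

+ℚ-cancelʳ-≤ : ∀ r p q → p ℚ.+ r ℚ.≤ q ℚ.+ r → p ℚ.≤ q
+ℚ-cancelʳ-≤ r p q h = subst₂ ℚ._≤_ (cancel p r) (cancel q r) (ℚ.+-monoˡ-≤ (ℚ.- r) h)
  where
  open ℚ-Solver
  cancel : ∀ p r → (p ℚ.+ r) ℚ.- r ≡ p
  cancel = solve 2 (λ p r → (p :+ r) :- r := p) ≡.refl

pointwise-≤ : ∀ {x y} → (∀ n → seq x n ℚ.≤ seq y n) → x ≤ y
pointwise-≤ {x} {y} h = *≤* λ ε 0<ε → 0 , λ n _ → ℚ.≤-trans (h n) (ℚ.<⇒≤ (p<p+ε (seq y n) 0<ε))

≤-reflexive : ∀ {x y} → x ≈ y → x ≤ y
≤-reflexive (*≈* h) = *≤* λ ε 0<ε →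
  let N , f = h ε 0<ε in N , λ n N≤n → ℚ.<⇒≤ (∣p-q∣<-elim (f n N≤n))

≤-refl : ∀ {x} → x ≤ x
≤-refl = ≤-reflexive ≈-refl

≤-trans : ∀ {x y z} → x ≤ y → y ≤ z → x ≤ z
≤-trans {x} {y} {z} (*≤* h) (*≤* k) = *≤* λ ε 0<ε →
  let N , f = h (½ ℚ.* ε) (half-pos 0<ε)
      K , g = k (½ ℚ.* ε) (half-pos 0<ε)
  in N ℕ.⊔ K , λ n le → subst (seq x n ℚ.≤_) (half-half (seq z n) ε)
       (ℚ.≤-trans (f n (⊔ˡ le)) (ℚ.+-monoˡ-≤ (½ ℚ.* ε) (g n (⊔ʳ {N} le))))

≤-antisym : ∀ {x y} → x ≤ y → y ≤ x → x ≈ y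
≤-antisym {x} {y} (*≤* h) (*≤* k) = *≈* λ ε 0<ε →
  let N , f = h (½ ℚ.* ε) (half-pos 0<ε)
      K , g = k (½ ℚ.* ε) (half-pos 0<ε)
      strict : ∀ p → p ℚ.+ ½ ℚ.* ε ℚ.< p ℚ.+ ε
      strict p = subst (p ℚ.+ ½ ℚ.* ε ℚ.<_) (half-half p ε) (p<p+ε (p ℚ.+ ½ ℚ.* ε) (half-pos 0<ε))
  in N ℕ.⊔ K , λ n le → ∣p-q∣<-intro
       (ℚ.≤-<-trans (f n (⊔ˡ le)) (strict (seq y n)))
       (ℚ.≤-<-trans (g n (⊔ʳ {N} le)) (strict (seq x n)))

<⇒≤ : ∀ {x y} → x < y → x ≤ y
<⇒≤ {x} (*<* (g , 0<g , N , f)) = *≤* λ ε 0<ε → N , λ n N≤n →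
  ℚ.≤-trans (ℚ.<⇒≤ (p<p+ε (seq x n) 0<g)) (ℚ.≤-trans (f n N≤n) (ℚ.<⇒≤ (p<p+ε _ 0<ε)))

<-≤-trans : ∀ {x y z} → x < y → y ≤ z → x < z
<-≤-trans {x} {y} {z} (*<* (g , 0<g , N , f)) (*≤* k) =
  let K , h = k (½ ℚ.* g) (half-pos 0<g)
  in *<* (½ ℚ.* g , half-pos 0<g , N ℕ.⊔ K , λ n le →
       +ℚ-cancelʳ-≤ (½ ℚ.* g) (seq x n ℚ.+ ½ ℚ.* g) (seq z n)
         (ℚ.≤-trans (ℚ.≤-reflexive (half-half (seq x n) g))
           (ℚ.≤-trans (f n (⊔ˡ le)) (h n (⊔ʳ {N} le)))))

≤-<-trans : ∀ {x y z} → x ≤ y → y < z → x < z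
≤-<-trans {x} {y} {z} (*≤* k) (*<* (g , 0<g , N , f)) =
  let K , h = k (½ ℚ.* g) (half-pos 0<g)
  in *<* (½ ℚ.* g , half-pos 0<g , N ℕ.⊔ K , λ n le →
       ℚ.≤-trans (ℚ.+-monoˡ-≤ (½ ℚ.* g) (h n (⊔ʳ {N} le)))
         (ℚ.≤-trans (ℚ.≤-reflexive (half-half (seq y n) g)) (f n (⊔ˡ le))))

<-irrefl : ∀ {x} → ¬ (x < x)
<-irrefl {x} (*<* (g , 0<g , N , f)) =
  ℚ.<-irrefl ≡.refl (ℚ.<-≤-trans (p<p+ε (seq x N) 0<g) (f N ℕ.≤-refl))

≤⇒≯ : ∀ {x y} → x ≤ y → ¬ (y < x)
≤⇒≯ x≤y y<x = <-irrefl (≤-<-trans x≤y y<x)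

fromℚ-mono-< : ∀ {p q} → p ℚ.< q → fromℚ p < fromℚ q
fromℚ-mono-< {p} {q} p<q = *<* (q ℚ.- p , 0<q-p , 0 , λ _ _ →
  ℚ.≤-reflexive (solve 2 (λ a b → a :+ (b :- a) := b) ≡.refl p q))
  where
  open ℚ-Solver
  0<q-p : 0ℚ ℚ.< q ℚ.- p
  0<q-p = subst (ℚ._< q ℚ.- p) (ℚ.+-inverseʳ p) (ℚ.+-monoˡ-< (ℚ.- p) p<q)

≤⇒0≤- : ∀ {x y} → x ≤ y → 0ℝ ≤ y - x
≤⇒0≤- {x} {y} (*≤* h) = *≤* λ ε 0<ε →
  let N , f = h ε 0<ε in N , λ n le →
    subst₂ ℚ._≤_ (ℚ.+-inverseʳ (seq x n))
      (solve 3 (λ a b e → (b :+ e) :- a := (b :- a) :+ e) ≡.refl (seq x n) (seq y n) ε)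
      (ℚ.+-monoˡ-≤ (ℚ.- seq x n) (f n le))
  where open ℚ-Solver

-- Reduces an inequality to a ring identity, with e a combination of nonnegative terms.
by-nonneg : ∀ {x y e} → 0ℝ ≤ e → y - x ≈ e → x ≤ y
by-nonneg {x} {y} {e} 0≤e eq = *≤* λ ε 0<ε →
  let N , f = _≤_.eventually (≤-trans 0≤e (≤-reflexive (≈-sym eq))) ε 0<ε in N , λ n le →
    subst₂ ℚ._≤_ (ℚ.+-identityʳ (seq x n))
      (solve 3 (λ a b e → a :+ ((b :- a) :+ e) := b :+ e) ≡.refl (seq x n) (seq y n) ε)
      (ℚ.+-monoʳ-≤ (seq x n) (f n le))
  where open ℚ-Solver

<⇒0<- : ∀ {x y} → x < y → 0ℝ < y - x
<⇒0<- {x} {y} (*<* (g , 0<g , N , f)) = *<* (g , 0<g , N , λ n le →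
  subst (ℚ._≤ seq y n ℚ.- seq x n) (solve 2 (λ a g → (a :+ g) :- a := con 0ℚ :+ g) ≡.refl (seq x n) g)
    (ℚ.+-monoˡ-≤ (ℚ.- seq x n) (f n le)))
  where open ℚ-Solver

by-pos : ∀ {x y e} → 0ℝ < e → y - x ≈ e → x < y
by-pos {x} {y} {e} 0<e eq =
  let g , 0<g , N , f = _<_.gap (<-≤-trans 0<e (≤-reflexive (≈-sym eq)))
  in *<* (g , 0<g , N , λ n le →
    subst₂ ℚ._≤_ (cong (seq x n ℚ.+_) (ℚ.+-identityˡ g))
      (solve 2 (λ a b → a :+ (b :- a) := b) ≡.refl (seq x n) (seq y n))
      (ℚ.+-monoʳ-≤ (seq x n) (f n le)))
  where open ℚ-Solver

+-nonneg : ∀ {x y} → 0ℝ ≤ x → 0ℝ ≤ y → 0ℝ ≤ x + y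
+-nonneg {x} {y} 0≤x 0≤y = ≤-trans 0≤x (by-nonneg 0≤y
  (solve 2 (λ x y → x :+ y :- x := y) ≈-refl x y))
  where open ℝ-Solver

+-pos : ∀ {x y} → 0ℝ < x → 0ℝ ≤ y → 0ℝ < x + y
+-pos {x} {y} 0<x 0≤y = <-≤-trans 0<x (by-nonneg 0≤y
  (solve 2 (λ x y → x :+ y :- x := y) ≈-refl x y))
  where open ℝ-Solver

x²-nonneg : ∀ x → 0ℝ ≤ x ²
x²-nonneg x = pointwise-≤ λ n → sq-nonneg (seq x n)
  where
  sq-nonneg : ∀ p → 0ℚ ℚ.≤ p ℚ.* p
  sq-nonneg p = subst (0ℚ ℚ.≤_) (≡.trans (≡.sym (ℚ.∣p*q∣≡∣p∣*∣q∣ p p)) (lemma p)) (0≤∣p∣*∣p∣ p)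
    where
    0≤∣p∣*∣p∣ : ∀ p → 0ℚ ℚ.≤ ℚ.∣ p ∣ ℚ.* ℚ.∣ p ∣
    0≤∣p∣*∣p∣ p = subst (ℚ._≤ ℚ.∣ p ∣ ℚ.* ℚ.∣ p ∣) (ℚ.*-zeroʳ ℚ.∣ p ∣) (*-monoˡ-≤ (ℚ.0≤∣p∣ p) (ℚ.0≤∣p∣ p))
    lemma : ∀ p → ℚ.∣ p ℚ.* p ∣ ≡ p ℚ.* p
    lemma p with ℚ.∣p∣≡p∨∣p∣≡-p p
    ... | inj₁ eq = ≡.trans (ℚ.∣p*q∣≡∣p∣*∣q∣ p p) (≡.cong₂ ℚ._*_ eq eq)
    ... | inj₂ eq = ≡.trans (ℚ.∣p*q∣≡∣p∣*∣q∣ p p) (≡.trans (≡.cong₂ ℚ._*_ eq eq)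
                     (solve 1 (λ a → (:- a) :* (:- a) := a :* a) ≡.refl p))
      where open ℚ-Solver

*-positive : ∀ {x y} → 0ℝ < x → 0ℝ < y → 0ℝ < x * y
*-positive {x} {y} (*<* (a , 0<a , N , f)) (*<* (b , 0<b , K , g)) =
  *<* (a ℚ.* b , *-pos 0<a 0<b , N ℕ.⊔ K , λ n le →
    let a≤ = ℚ.≤-trans (ℚ.≤-reflexive (≡.sym (ℚ.+-identityˡ a))) (f n (⊔ˡ le))
        b≤ = ℚ.≤-trans (ℚ.≤-reflexive (≡.sym (ℚ.+-identityˡ b))) (g n (⊔ʳ {N} le))
    in ℚ.≤-trans (ℚ.≤-reflexive (ℚ.+-identityˡ (a ℚ.* b)))
         (ℚ.≤-trans (*-monoˡ-≤ (ℚ.<⇒≤ 0<a) b≤) (*-monoʳ-≤ (ℚ.≤-trans (ℚ.<⇒≤ 0<b) b≤) a≤)))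

-- A single term of the sequence, accurate to ε/4, is compared with ε/2. This rational comparison is
-- the source of every case distinction on the size of a real below.
<-or-pos : ∀ {ε} → 0ℚ ℚ.< ε → ∀ x → x < fromℚ ε ⊎ 0ℝ < x
<-or-pos {ε} 0<ε x = let N , f = ℝ.cauchy x ¼ε 0<¼ε in decide N f
  where
  ¼ε = ½ ℚ.* (½ ℚ.* ε)
  0<¼ε = half-pos (half-pos 0<ε)
  decide : ∀ N → (∀ m n → N ℕ.≤ m → N ℕ.≤ n → ℚ.∣ seq x m ℚ.- seq x n ∣ ℚ.< ¼ε) → x < fromℚ ε ⊎ 0ℝ < x
  decide N f with seq x N ℚ.≤? ½ ℚ.* ε
  ... | yes x≤ = inj₁ (*<* (¼ε , 0<¼ε , N , λ n le → ℚ.≤-trans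
          (ℚ.+-monoˡ-≤ ¼ε (ℚ.≤-trans (ℚ.<⇒≤ (∣p-q∣<-elim {seq x n} {seq x N} (f n N le ℕ.≤-refl)))
            (ℚ.+-monoˡ-≤ ¼ε x≤)))
          (ℚ.≤-reflexive (≡.trans (half-half (½ ℚ.* ε) (½ ℚ.* ε)) (ε/2+ε/2≡ε ε)))))
  ... | no x≰ = inj₂ (*<* (¼ε , 0<¼ε , N , λ n le → +ℚ-cancelʳ-≤ ¼ε (0ℚ ℚ.+ ¼ε) (seq x n) (ℚ.≤-trans
          (ℚ.≤-reflexive (≡.trans (half-half 0ℚ (½ ℚ.* ε)) (ℚ.+-identityˡ (½ ℚ.* ε))))
          (ℚ.≤-trans (ℚ.<⇒≤ (ℚ.≰⇒> x≰)) (ℚ.<⇒≤ (∣p-q∣<-elim {seq x N} {seq x n} (f N n ℕ.≤-refl le)))))))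

<⇒rational-gap : ∀ {x y} → x < y → ∃[ g ] (0ℚ ℚ.< g × x + fromℚ g ≤ y)
<⇒rational-gap {x} {y} (*<* (g , 0<g , N , f)) = g , 0<g , *≤* λ ε 0<ε → N , λ n le →
  ℚ.≤-trans (f n le) (ℚ.<⇒≤ (p<p+ε (seq y n) 0<ε))

cotransitive : ∀ {x y} → x < y → ∀ z → x < z ⊎ z < y
cotransitive {x} {y} x<y z =
  let g , 0<g , x+g≤y = <⇒rational-gap x<y in compare g x+g≤y (<-or-pos 0<g (z - x))
  where
  open ℝ-Solver
  compare : ∀ g → x + fromℚ g ≤ y → z - x < fromℚ g ⊎ 0ℝ < z - x → x < z ⊎ z < y
  compare g x+g≤y (inj₁ z-x<g) = inj₂ (by-pos (+-pos (<⇒0<- z-x<g) (≤⇒0≤- x+g≤y))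
    (solve 4 (λ x y z g → y :- z := (g :- (z :- x)) :+ (y :- (x :+ g))) ≈-refl x y z (fromℚ g)))
  compare g x+g≤y (inj₂ 0<z-x) = inj₁ (by-pos 0<z-x ≈-refl)

-- `_≤_` only asks for a bound at each rational ε, and `<-or-pos` supplies it once its second
-- alternative is excluded. Weak inequalities can thus be proved by contradiction.
≮⇒≥ : ∀ {x y} → ¬ (x < y) → y ≤ x
≮⇒≥ {x} {y} x≮y = *≤* λ ε 0<ε → bound ε 0<ε (<-or-pos 0<ε (y - x))
  where
  bound : ∀ ε → 0ℚ ℚ.< ε → y - x < fromℚ ε ⊎ 0ℝ < y - x → ∃[ N ] ∀ n → N ℕ.≤ n → seq y n ℚ.≤ seq x n ℚ.+ ε
  bound ε 0<ε (inj₂ 0<y-x) = ⊥-elim (x≮y (by-pos 0<y-x ≈-refl))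
  bound ε 0<ε (inj₁ (*<* (g , 0<g , N , f))) = N , λ n le → subst (ℚ._≤ seq x n ℚ.+ ε)
    (solve 2 (λ x y → x :+ (y :- x) := y) ≡.refl (seq x n) (seq y n))
    (ℚ.+-monoʳ-≤ (seq x n) (ℚ.≤-trans (ℚ.<⇒≤ (p<p+ε _ 0<g)) (f n le)))
    where open ℚ-Solver

-- If the product were negative, x and y could not both be positive; so x > 0 would force y ≈ 0, and
-- otherwise x ≈ 0. Either way the product vanishes.
*-nonneg : ∀ {x y} → 0ℝ ≤ x → 0ℝ ≤ y → 0ℝ ≤ x * y
*-nonneg {x} {y} 0≤x 0≤y = ≮⇒≥ λ xy<0 →
  let x≯0 : ¬ (0ℝ < x)
      x≯0 0<x =
        let y≯0 : ¬ (0ℝ < y)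
            y≯0 0<y = <-irrefl (≤-<-trans (<⇒≤ (*-positive 0<x 0<y)) xy<0)
        in vanishing (≈-trans (*-congˡ {x} (≤-antisym (≮⇒≥ y≯0) 0≤y)) (zeroʳ x)) xy<0
  in vanishing (≈-trans (*-congʳ {y} (≤-antisym (≮⇒≥ x≯0) 0≤x)) (zeroˡ y)) xy<0
  where
  vanishing : ∀ {z} → z ≈ 0ℝ → ¬ (z < 0ℝ)
  vanishing z≈0 z<0 = <-irrefl (≤-<-trans (≤-reflexive (≈-sym z≈0)) z<0)

open ℝ-Solver using (solve; con; _:=_; _:+_; _:*_; _:-_; :-_)

+-mono-≤ : ∀ {x x′ y y′} → x ≤ x′ → y ≤ y′ → x + y ≤ x′ + y′
+-mono-≤ {x} {x′} {y} {y′} x≤x′ y≤y′ = by-nonneg (+-nonneg (≤⇒0≤- x≤x′) (≤⇒0≤- y≤y′))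
  (solve 4 (λ x x′ y y′ → (x′ :+ y′) :- (x :+ y) := (x′ :- x) :+ (y′ :- y)) ≈-refl x x′ y y′)

*-monoˡ-≤-nonneg : ∀ {r x y} → 0ℝ ≤ r → x ≤ y → r * x ≤ r * y
*-monoˡ-≤-nonneg {r} {x} {y} 0≤r x≤y = by-nonneg (*-nonneg 0≤r (≤⇒0≤- x≤y))
  (solve 3 (λ r x y → r :* y :- r :* x := r :* (y :- x)) ≈-refl r x y)

²-cancel-≤ : ∀ {x y} → 0ℝ ≤ y → x ² ≤ y ² → x ≤ y
²-cancel-≤ {x} {y} 0≤y x²≤y² = ≮⇒≥ λ y<x → ≤⇒≯ x²≤y²
  (by-pos (*-positive (<⇒0<- y<x) (+-pos (≤-<-trans 0≤y y<x) 0≤y))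
    (solve 2 (λ x y → x :* x :- y :* y := (x :- y) :* (x :+ y)) ≈-refl x y))

√-mono : ∀ {x y} → 0ℝ ≤ x → x ≤ y → √ x ≤ √ y
√-mono {x} {y} 0≤x x≤y = ²-cancel-≤ (√-nonneg y)
  (≤-trans (≤-reflexive (√-sq x 0≤x))
    (≤-trans x≤y (≤-reflexive (≈-sym (√-sq y (≤-trans 0≤x x≤y))))))

√-cong : ∀ {x y} → 0ℝ ≤ x → x ≈ y → √ x ≈ √ y
√-cong 0≤x x≈y = ≤-antisym (√-mono 0≤x (≤-reflexive x≈y))
  (√-mono (≤-trans 0≤x (≤-reflexive x≈y)) (≤-reflexive (≈-sym x≈y)))

*-pos-cancel-0 : ∀ {x y} → 0ℝ < x → x * y ≈ 0ℝ → y ≈ 0ℝ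
*-pos-cancel-0 {x} {y} 0<x xy≈0 = ≤-antisym (≮⇒≥ y≯0) (≮⇒≥ y≮0)
  where
  y≯0 : ¬ (0ℝ < y)
  y≯0 0<y = ≤⇒≯ (≤-reflexive xy≈0) (*-positive 0<x 0<y)
  y≮0 : ¬ (y < 0ℝ)
  y≮0 y<0 = ≤⇒≯ (≤-reflexive (≈-sym xy≈0)) (by-pos (*-positive 0<x (<⇒0<- y<0))
    (solve 2 (λ x y → con 0ℚ :- x :* y := x :* (con 0ℚ :- y)) ≈-refl x y))

fromℚ-mono-≤ : ∀ {p q} → p ℚ.≤ q → fromℚ p ≤ fromℚ q
fromℚ-mono-≤ p≤q = pointwise-≤ λ _ → p≤q

≤-rational-bound : ∀ x → ∃[ M ] (0ℚ ℚ.< M × x ≤ fromℚ M)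
≤-rational-bound x =
  let M , 0<M , N , f = bounded x
  in M , 0<M , *≤* λ ε 0<ε → N , λ n le →
       ℚ.≤-trans (p≤∣p∣ (seq x n)) (ℚ.≤-trans (f n le) (ℚ.<⇒≤ (p<p+ε M 0<ε)))

-- Reciprocals and the Archimedean property

1/[1+_] : ℕ → ℝ
1/[1+ n ] = fromℚ (u n)

0<1/[1+_] : ∀ n → 0ℝ < 1/[1+ n ]
0<1/[1+ n ] = fromℚ-mono-< (0<u n)

archimedean : ∀ x {y} → 0ℝ < y → ∃[ N ] ∀ n → N ℕ.≤ n → 1/[1+ n ] * x < y
archimedean x {y} 0<y =
  let g , 0<g , g≤y   = <⇒rational-gap 0<y
      M , 0<M , x≤M   = ≤-rational-bound x
      δ , 0<δ , Mδ≡½g = divide 0<M (half-pos 0<g)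
      N , small       = u-small δ 0<δ
  in N , λ n N≤n → ≤-<-trans
       (≤-trans (*-monoˡ-≤-nonneg (<⇒≤ 0<1/[1+ n ]) x≤M)
         (pointwise-≤ λ _ → ℚ.≤-trans (*-monoʳ-≤ (ℚ.<⇒≤ 0<M) (small n N≤n))
           (ℚ.≤-reflexive (≡.trans (ℚ.*-comm δ M) Mδ≡½g))))
       (<-≤-trans (fromℚ-mono-< (½g<g g 0<g))
         (≤-trans (≤-reflexive (solve 1 (λ g → g := con 0ℚ :+ g) ≈-refl (fromℚ g))) g≤y))
  where
  ½g<g : ∀ g → 0ℚ ℚ.< g → ½ ℚ.* g ℚ.< g
  ½g<g g 0<g = subst (½ ℚ.* g ℚ.<_) (ε/2+ε/2≡ε g) (p<p+ε (½ ℚ.* g) (half-pos 0<g))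

fromℕ-suc : ∀ n → fromℕ (suc n) ≈ fromℕ n + 1ℝ
fromℕ-suc n = pointwise λ _ → [1+k]/n≡k/n+u n 0

0≤fromℕ : ∀ n → 0ℝ ≤ fromℕ n
0≤fromℕ n = fromℚ-mono-≤ (0≤k/n n 0)

0<fromℕ-suc : ∀ n → 0ℝ < fromℕ (suc n)
0<fromℕ-suc n = <-≤-trans (fromℚ-mono-< (ℚ.positive⁻¹ 1ℚ)) (fromℚ-mono-≤ (1≤[1+k] n))

fromℕ-mono-≤ : ∀ {m n} → m ℕ.≤ n → fromℕ m ≤ fromℕ n
fromℕ-mono-≤ {n = n} ℕ.z≤n = 0≤fromℕ n
fromℕ-mono-≤ (ℕ.s≤s {m} {n} m≤n) = ≤-trans (≤-reflexive (fromℕ-suc m))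
  (≤-trans (+-mono-≤ (fromℕ-mono-≤ m≤n) ≤-refl) (≤-reflexive (≈-sym (fromℕ-suc n))))

fromℕ-*-1/ : ∀ n → fromℕ (suc n) * 1/[1+ n ] ≈ 1ℝ
fromℕ-*-1/ n = pointwise λ _ → ≡.trans (≡.sym (k/n≡k*u (suc n)))
  (≡.trans (cong (λ k → + k / suc n) (≡.sym (ℕ.*-identityˡ (suc n)))) (bn/n≡b 1 n))
  where
  k/n≡k*u : ∀ k → + k / suc n ≡ (+ k / 1) ℚ.* u n
  k/n≡k*u zero    = ≡.trans (ℚ.0/n≡0 (suc n)) (≡.sym (ℚ.*-zeroˡ (u n)))
  k/n≡k*u (suc k) = ≡.trans ([1+k]/n≡k/n+u k n) (≡.trans
    (≡.cong₂ ℚ._+_ (k/n≡k*u k) (≡.sym (ℚ.*-identityˡ (u n))))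
    (≡.trans (≡.sym (ℚ.*-distribʳ-+ (u n) (+ k / 1) 1ℚ))
      (cong (ℚ._* u n) (≡.sym ([1+k]/n≡k/n+u k 0)))))

multiples-unbounded : ∀ x {y} → 0ℝ < y → ∃[ k ] x < fromℕ k * y
multiples-unbounded x {y} 0<y =
  let N , small = archimedean x 0<y
  in suc N , by-pos (*-positive (0<fromℕ-suc N) (<⇒0<- (small N ℕ.≤-refl))) (≈-trans
       (solve 3 (λ k y x → k :* y :- x := k :* y :- con 1ℚ :* x) ≈-refl (fromℕ (suc N)) y x)
       (≈-trans (+-congˡ {fromℕ (suc N) * y} (-‿cong (*-congʳ {x} (≈-sym (fromℕ-*-1/ N)))))
         (solve 4 (λ k v y x → k :* y :- k :* v :* x := k :* (y :- v :* x)) ≈-refl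
           (fromℕ (suc N)) 1/[1+ N ] y x)))

-- Finite sums and squared norms

sum-cong : ∀ {k} {f g : Fin k → ℝ} → (∀ i → f i ≈ g i) → sum f ≈ sum g
sum-cong {k} = sum-cong-≋ {k}

sum-mono-≤ : ∀ {k} {f g : Fin k → ℝ} → (∀ i → f i ≤ g i) → sum f ≤ sum g
sum-mono-≤ {zero}  f≤g = ≤-refl
sum-mono-≤ {suc k} f≤g = +-mono-≤ (f≤g zero) (sum-mono-≤ (f≤g ∘ suc))

sum-nonneg : ∀ {k} {f : Fin k → ℝ} → (∀ i → 0ℝ ≤ f i) → 0ℝ ≤ sum f
sum-nonneg {zero}  0≤f = ≤-refl
sum-nonneg {suc k} 0≤f = +-nonneg (0≤f zero) (sum-nonneg (0≤f ∘ suc))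

sum-const : ∀ k x → ∑[ i < k ] x ≈ fromℕ k * x
sum-const zero    x = ≈-sym (zeroˡ x)
sum-const (suc k) x = ≈-trans (+-congˡ {x} (sum-const k x))
  (≈-trans (solve 2 (λ k x → x :+ k :* x := (k :+ con 1ℚ) :* x) ≈-refl (fromℕ k) x)
    (*-congʳ {x} (≈-sym (fromℕ-suc k))))

sum-linear : ∀ {k} a b (f g : Fin k → ℝ) → ∑[ i < k ] (a * f i + b * g i) ≈ a * sum f + b * sum g
sum-linear {k} a b f g = ≈-trans (∑-distrib-+ {k} (λ i → a * f i) (λ i → b * g i))
  (+-cong (≈-sym (*-distribˡ-sum {k} a f)) (≈-sym (*-distribˡ-sum {k} b g)))

normSq : ∀ {n} → Point n → ℝ
normSq {n} v = ∑[ l < n ] (v l ²)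

normSq-nonneg : ∀ {n} (v : Point n) → 0ℝ ≤ normSq v
normSq-nonneg v = sum-nonneg λ l → x²-nonneg (v l)

normSq-cong : ∀ {n} {v w : Point n} → v ≈ᵖ w → normSq v ≈ normSq w
normSq-cong v≈w = sum-cong λ l → *-cong (v≈w l) (v≈w l)

‖‖²≈normSq : ∀ {n} (v : Point n) → ‖ v ‖ ² ≈ normSq v
‖‖²≈normSq v = √-sq (normSq v) (normSq-nonneg v)

-- Jung's theorem

2ℝ : ℝ
2ℝ = fromℕ 2

:2 : ∀ {n} → ℝ-Solver.Polynomial n
:2 = con (+ 2 / 1)

interpolate : ∀ {n} → ℝ → Point n → Point n → Point n
interpolate t q b l = (1ℝ - t) * q l + t * b l

stewart : ∀ {n} t (x q b : Point n) →
  normSq (x -ᵖ interpolate t q b) + t * (1ℝ - t) * normSq (b -ᵖ q)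
    ≈ (1ℝ - t) * normSq (x -ᵖ q) + t * normSq (x -ᵖ b)
stewart {n} t x q b = ≈-trans
  (≈-trans (+-congʳ {t * (1ℝ - t) * normSq (b -ᵖ q)}
    (≈-sym (*-identityˡ (normSq (x -ᵖ interpolate t q b)))))
    (≈-sym (sum-linear {n} 1ℝ (t * (1ℝ - t)) _ _)))
  (≈-trans (sum-cong λ l → solve 4 (λ t x q b →
      let q′ = (con 1ℚ :- t) :* q :+ t :* b in
      con 1ℚ :* ((x :- q′) :* (x :- q′)) :+ t :* (con 1ℚ :- t) :* ((b :- q) :* (b :- q))
        := (con 1ℚ :- t) :* ((x :- q) :* (x :- q)) :+ t :* ((x :- b) :* (x :- b)))
      ≈-refl t (x l) (q l) (b l))
    (sum-linear {n} (1ℝ - t) t _ _))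

all-or-some : ∀ {m} {P Q : Fin m → Set} → (∀ i → P i ⊎ Q i) → (∀ i → P i) ⊎ (∃[ i ] Q i)
all-or-some {zero}  dec = inj₁ λ ()
all-or-some {suc m} {P} {Q} dec = combine (dec zero) (all-or-some (dec ∘ suc))
  where
  combine : P zero ⊎ Q zero → (∀ i → P (suc i)) ⊎ (∃[ i ] Q (suc i)) → (∀ i → P i) ⊎ (∃[ i ] Q i)
  combine (inj₂ q) _              = inj₂ (zero , q)
  combine (inj₁ p) (inj₂ (i , q)) = inj₂ (suc i , q)
  combine (inj₁ p) (inj₁ ps)      = inj₁ λ { zero → p ; (suc i) → ps i }

-- The exact centre is the mean of a measure of maximal variance. The search stops short of this
-- maximum, at the price of 2ε in the squared radius.
module ApproximateJung {m n} (b : Fin (suc m) → Point n)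
  (b-close : ∀ i j → normSq (b i -ᵖ b j) ≤ 2ℝ) {ε} (0<ε : 0ℝ < ε) (ε<1 : ε < 1ℝ) where

  -- Here q and v are the mean and the variance of a probability measure on the points b j.  While some
  -- b i is far from q, moving the proportion ε of the mass to b i increases v, which is at most 2, by
  -- a fixed gain.
  Spread : Point n → ℝ → Set
  Spread q v = ∀ j → normSq (b j -ᵖ q) + v ≤ 2ℝ

  gain : ℝ
  gain = ε * (ε * (1ℝ - ε))

  0<1-ε : 0ℝ < 1ℝ - ε
  0<1-ε = <⇒0<- ε<1

  0<gain : 0ℝ < gain
  0<gain = *-positive 0<ε (*-positive 0<ε 0<1-ε)

  moved : ℝ → ℝ → ℝ
  moved v y = (1ℝ - ε) * v + ε * (1ℝ - ε) * y

  -- By `stewart` the new left side is the convex combination, with weights 1 - ε and ε, of the old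
  -- one and of ‖bⱼ - bᵢ‖², both at most 2.
  move-spread : ∀ {q v} i → Spread q v → Spread (interpolate ε q (b i)) (moved v (normSq (b i -ᵖ q)))
  move-spread {q} {v} i spread j = ≤-trans (≤-reflexive regroup)
    (by-nonneg (+-nonneg (*-nonneg (<⇒≤ 0<1-ε) (≤⇒0≤- (spread j)))
        (*-nonneg (<⇒≤ 0<ε) (≤⇒0≤- (b-close j i))))
      (solve 4 (λ e y v z → :2 :- ((con 1ℚ :- e) :* (y :+ v) :+ e :* z) :=
         (con 1ℚ :- e) :* (:2 :- (y :+ v)) :+ e :* (:2 :- z))
        ≈-refl ε (normSq (b j -ᵖ q)) v (normSq (b j -ᵖ b i))))
    where
    q′ = interpolate ε q (b i)
    y  = normSq (b i -ᵖ q)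
    regroup : normSq (b j -ᵖ q′) + moved v y ≈ (1ℝ - ε) * (normSq (b j -ᵖ q) + v) + ε * normSq (b j -ᵖ b i)
    regroup = ≈-trans (solve 4 (λ w e v y → w :+ ((con 1ℚ :- e) :* v :+ e :* (con 1ℚ :- e) :* y)
                := (w :+ e :* (con 1ℚ :- e) :* y) :+ (con 1ℚ :- e) :* v) ≈-refl (normSq (b j -ᵖ q′)) ε v y)
      (≈-trans (+-congʳ {(1ℝ - ε) * v} (stewart ε (b j) q (b i)))
        (solve 4 (λ e w z v → ((con 1ℚ :- e) :* w :+ e :* z) :+ (con 1ℚ :- e) :* v
          := (con 1ℚ :- e) :* (w :+ v) :+ e :* z) ≈-refl ε (normSq (b j -ᵖ q)) (normSq (b j -ᵖ b i)) v))

  -- The increase is ε ((1 - ε) y - v), which by v ≤ 2 - y is at least ε ((2 - ε) y - 2). At y = 1 +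
  -- ε this is ε² (1 - ε).
  move-gain : ∀ {y v} → 1ℝ + ε < y → y + v ≤ 2ℝ → v + gain ≤ moved v y
  move-gain {y} {v} 1+ε<y y+v≤2 = by-nonneg
    (+-nonneg (*-nonneg 0≤ε (≤⇒0≤- y+v≤2)) (*-nonneg 0≤ε (+-nonneg (*-nonneg (<⇒≤ 0<1-ε) 0≤p) 0≤p)))
    (solve 3 (λ e y v → ((con 1ℚ :- e) :* v :+ e :* (con 1ℚ :- e) :* y) :- (v :+ e :* (e :* (con 1ℚ :- e)))
      := e :* (:2 :- (y :+ v)) :+
         e :* ((con 1ℚ :- e) :* (y :- (con 1ℚ :+ e)) :+ (y :- (con 1ℚ :+ e)))) ≈-refl ε y v)
    where
    0≤ε = <⇒≤ 0<ε
    0≤p = ≤⇒0≤- (<⇒≤ 1+ε<y)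

  Centre : Set
  Centre = Σ[ q ∈ Point n ] (∀ j → normSq (b j -ᵖ q) ≤ 1ℝ + ε + ε)

  -- `k` is the number of moves left. The last premise survives each move, and at k = 0 it reads 2 <
  -- v, which `Spread` refutes.
  search : ∀ k q v → Spread q v → 2ℝ < v + fromℕ k * gain → Centre
  search zero q v spread 2<v = ⊥-elim (≤⇒≯
    (≤-trans (by-nonneg (normSq-nonneg (b zero -ᵖ q))
        (solve 3 (λ y v g → (y :+ v) :- (v :+ con 0ℚ :* g) := y) ≈-refl (normSq (b zero -ᵖ q)) v gain))
      (spread zero)) 2<v)
  search (suc k) q v spread 2<v+[1+k]γ = continue (all-or-some test)
    where
    test : ∀ j → normSq (b j -ᵖ q) < 1ℝ + ε + ε ⊎ 1ℝ + ε < normSq (b j -ᵖ q)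
    -- The two thresholds 1 + ε and 1 + 2ε leave the room that `cotransitive` requires.
    test j = swap (cotransitive (by-pos 0<ε (solve 1 (λ e → (con 1ℚ :+ e :+ e) :- (con 1ℚ :+ e) := e) ≈-refl ε))
               (normSq (b j -ᵖ q)))
    continue : (∀ j → normSq (b j -ᵖ q) < 1ℝ + ε + ε) ⊎ (∃[ j ] 1ℝ + ε < normSq (b j -ᵖ q)) → Centre
    continue (inj₁ close)     = q , λ j → <⇒≤ (close j)
    continue (inj₂ (i , far)) = search k (interpolate ε q (b i)) (moved v (normSq (b i -ᵖ q))) (move-spread i spread)
      (<-≤-trans 2<v+[1+k]γ (≤-trans
        (≤-reflexive (≈-trans (+-congˡ {v} (*-congʳ {gain} (fromℕ-suc k)))
          (solve 3 (λ v k g → v :+ (k :+ con 1ℚ) :* g := (v :+ g) :+ k :* g) ≈-refl v (fromℕ k) gain)))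
        (+-mono-≤ (move-gain far (spread i)) ≤-refl)))

  centre : Centre
  centre =
    let k , 2<kγ = multiples-unbounded 2ℝ 0<gain
    in search k (b zero) 0ℝ
         (λ j → ≤-trans (≤-reflexive (+-identityʳ (normSq (b j -ᵖ b zero)))) (b-close j zero))
         (<-≤-trans 2<kγ (≤-reflexive (≈-sym (solve 1 (λ x → con 0ℚ :+ x := x) ≈-refl (fromℕ k * gain)))))

approximate-jung : ∀ {m n} (b : Fin m → Point n) → (∀ i j → normSq (b i -ᵖ b j) ≤ 2ℝ) →
  ∀ {ε} → 0ℝ < ε → ε < 1ℝ → Σ[ q ∈ Point n ] (∀ j → normSq (b j -ᵖ q) ≤ 1ℝ + ε + ε)
approximate-jung {zero}  b b-close 0<ε ε<1 = (λ _ → 0ℝ) , λ ()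
approximate-jung {suc m} b b-close 0<ε ε<1 = ApproximateJung.centre b b-close 0<ε ε<1

-- Shells and circumradii

module Shells {θ} (0<θ : 0ℝ < θ) where

  -- The intervals [(k - 1)θ, (k + 1)θ] overlap: on which side of a common boundary a real lies
  -- cannot be decided, but a choice across a gap of θ can be made.
  InShell : ℕ → ℝ → Set
  InShell k x = fromℕ k * θ ≤ x + θ × x ≤ fromℕ (suc k) * θ

  shell : ∀ K x → 0ℝ ≤ x → x ≤ fromℕ (suc K) * θ → ∃[ k ] k ℕ.< suc K × InShell k x
  shell zero    x 0≤x x≤ = 0 , ℕ.≤-refl ,
    ≤-trans (≤-reflexive (zeroˡ θ)) (+-nonneg 0≤x (<⇒≤ 0<θ)) , x≤
  shell (suc K) x 0≤x x≤ = choose (cotransitive (by-pos 0<θ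
      (≈-trans (+-congʳ { - (fromℕ K * θ)} (*-congʳ {θ} (fromℕ-suc K)))
        (solve 2 (λ k t → (k :+ con 1ℚ) :* t :- k :* t := t) ≈-refl (fromℕ K) θ))) x)
    where
    choose : fromℕ K * θ < x ⊎ x < fromℕ (suc K) * θ → ∃[ k ] k ℕ.< suc (suc K) × InShell k x
    choose (inj₁ K<x) = suc K , ℕ.≤-refl , ≤-trans
      (≤-reflexive (≈-trans (*-congʳ {θ} (fromℕ-suc K))
        (solve 2 (λ k t → (k :+ con 1ℚ) :* t := k :* t :+ t) ≈-refl (fromℕ K) θ)))
      (+-mono-≤ (<⇒≤ K<x) ≤-refl) , x≤
    choose (inj₂ x<) =
      let k , k≤K , in-shell = shell K x 0≤x (<⇒≤ x<)
      in k , ℕ.m≤n⇒m≤1+n k≤K , in-shell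

  same-shell : ∀ {k x y} → InShell k x → InShell k y → x ≤ y + (θ + θ)
  same-shell {k} {x} {y} (_ , x≤) (y≥ , _) = ≤-trans x≤ (≤-trans
    (≤-reflexive (≈-trans (*-congʳ {θ} (fromℕ-suc k))
      (solve 2 (λ k t → (k :+ con 1ℚ) :* t := k :* t :+ t) ≈-refl (fromℕ k) θ)))
    (≤-trans (+-mono-≤ y≥ ≤-refl)
      (≤-reflexive (solve 2 (λ y t → y :+ t :+ t := y :+ (t :+ t)) ≈-refl y θ))))

  -- On an overlap the choice made by `shell` may depend on the Cauchy sequence representing `f i`.
  -- This is harmless, since colours are attached to indices.
  shell-colouring : ∀ {m} K (f : Fin m → ℝ) → (∀ i → 0ℝ ≤ f i) → (∀ i → f i ≤ fromℕ (suc K) * θ) →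
    Σ[ χ ∈ (Fin m → Fin (suc K)) ] (∀ i j → χ i ≡ χ j → f i ≤ f j + (θ + θ))
  shell-colouring K f 0≤f f≤ = (λ i → fromℕ< (below i)) , λ i j eq →
    same-shell {index j}
      (subst (λ k → InShell k (f i))
        (Fin.fromℕ<-injective (index i) (index j) (below i) (below j) eq) (within i))
      (within j)
    where
    located = λ i → shell K (f i) (0≤f i) (f≤ i)
    index  = λ i → proj₁ (located i)
    below  = λ i → proj₁ (proj₂ (located i))
    within = λ i → proj₂ (proj₂ (located i))

-- Weighted sums of squared distances

module Weighted {k} (c : Fin k → ℝ) where

  W : ℝ
  W = sum c

  moment : ℝ → (Fin k → ℝ) → ℝ
  moment a x = ∑[ j < k ] (c j * ((a - x j) ²))

  X Y : (Fin k → ℝ) → ℝ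
  X x = ∑[ j < k ] (c j * x j)
  Y x = ∑[ j < k ] (c j * x j ²)

  sum-linear₃ : ∀ p q r (f g h : Fin k → ℝ) →
    ∑[ i < k ] (p * f i + (q * g i + r * h i)) ≈ p * sum f + (q * sum g + r * sum h)
  sum-linear₃ p q r f g h = ≈-trans
    (sum-cong λ i → +-congˡ {p * f i} (≈-sym (*-identityˡ (q * g i + r * h i))))
    (≈-trans (sum-linear {k} p 1ℝ f (λ i → q * g i + r * h i))
      (+-congˡ {p * sum f} (≈-trans (*-identityˡ (∑[ i < k ] (q * g i + r * h i))) (sum-linear {k} q r g h))))

  moment-expand : ∀ a x → moment a x ≈ a ² * W + ((- (2ℝ * a)) * X x + 1ℝ * Y x)
  moment-expand a x = ≈-trans
    (sum-cong λ j → solve 3 (λ c a x → c :* ((a :- x) :* (a :- x))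
       := (a :* a) :* c :+ ((:- (:2 :* a)) :* (c :* x) :+ con 1ℚ :* (c :* (x :* x)))) ≈-refl (c j) a (x j))
    (sum-linear₃ (a ²) (- (2ℝ * a)) 1ℝ c (λ j → c j * x j) (λ j → c j * x j ²))

  variance-scalar : ∀ (x : Fin k → ℝ) → ∑[ i < k ] (c i * moment (x i) x) ≈ 2ℝ * W * Y x - 2ℝ * (X x ²)
  variance-scalar x = ≈-trans
    (sum-cong λ i → ≈-trans (*-congˡ {c i} (moment-expand (x i) x))
      (solve 5 (λ c a w X Y → c :* ((a :* a) :* w :+ ((:- (:2 :* a)) :* X :+ con 1ℚ :* Y))
         := w :* (c :* (a :* a)) :+ ((:- (:2 :* X)) :* (c :* a) :+ Y :* c)) ≈-refl (c i) (x i) W (X x) (Y x)))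
    (≈-trans (sum-linear₃ W (- (2ℝ * X x)) (Y x) (λ i → c i * x i ²) (λ i → c i * x i) c)
      (solve 3 (λ w X Y → w :* Y :+ ((:- (:2 :* X)) :* X :+ Y :* w)
         := :2 :* w :* Y :- :2 :* (X :* X)) ≈-refl W (X x) (Y x)))

  weighted-swap : ∀ {n} (g : Fin k → Fin n → ℝ) →
    ∑[ j < k ] (c j * ∑[ l < n ] g j l) ≈ ∑[ l < n ] ∑[ j < k ] (c j * g j l)
  weighted-swap {n} g = ≈-trans (sum-cong λ j → *-distribˡ-sum {n} (c j) (g j)) (∑-comm {k} {n} λ j l → c j * g j l)

  -- In each coordinate the right side exceeds the left by 2 (∑ cⱼ xⱼ)², whatever the signs of the
  -- weights. This matters because the apex will have a negative weight.
  weighted-distances-≤ : ∀ {n} (v : Fin k → Point n) →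
    ∑[ i < k ] (c i * ∑[ j < k ] (c j * normSq (v i -ᵖ v j))) ≤ 2ℝ * W * ∑[ i < k ] (c i * normSq (v i))
  weighted-distances-≤ {n} v = ≤-trans
    (≤-reflexive (≈-trans
      (sum-cong λ i → *-congˡ {c i} (weighted-swap (λ j l → (v i l - v j l) ²)))
      (weighted-swap (λ i l → moment (v i l) (λ j → v j l)))))
    (≤-trans (sum-mono-≤ scalar)
      (≤-reflexive (≈-trans (≈-sym (*-distribˡ-sum {n} (2ℝ * W) (λ l → Y (λ j → v j l))))
        (*-congˡ {2ℝ * W} (≈-sym (weighted-swap (λ i l → v i l ²)))))))
    where
    scalar : ∀ l → ∑[ i < k ] (c i * moment (v i l) (λ j → v j l)) ≤ 2ℝ * W * Y (λ j → v j l)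
    scalar l = ≤-trans (≤-reflexive (variance-scalar (λ j → v j l)))
      (by-nonneg (+-nonneg (x²-nonneg X′) (x²-nonneg X′))
        (solve 3 (λ w X Y → :2 :* w :* Y :- (:2 :* w :* Y :- :2 :* (X :* X)) := X :* X :+ X :* X)
          ≈-refl W X′ (Y (λ j → v j l))))
      where X′ = X (λ j → v j l)

-- The simplex

≡⇒≈ : ∀ {x y : ℝ} → x ≡ y → x ≈ y
≡⇒≈ ≡.refl = ≈-refl

δ-sym : ∀ {k} (i j : Fin k) → δ i j ≡ δ j i
δ-sym zero    zero    = ≡.refl
δ-sym zero    (suc j) = ≡.refl
δ-sym (suc i) zero    = ≡.refl
δ-sym (suc i) (suc j) = δ-sym i j

0≤1 : 0ℝ ≤ 1ℝ
0≤1 = 0≤fromℕ 1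

δ-nonneg : ∀ {k} (i j : Fin k) → 0ℝ ≤ δ i j
δ-nonneg zero    zero    = 0≤1
δ-nonneg zero    (suc j) = ≤-refl
δ-nonneg (suc i) zero    = ≤-refl
δ-nonneg (suc i) (suc j) = δ-nonneg i j

normSq-swap : ∀ {n} (v w : Point n) → normSq (v -ᵖ w) ≈ normSq (w -ᵖ v)
normSq-swap v w = sum-cong λ l →
  solve 2 (λ v w → (v :- w) :* (v :- w) := (w :- v) :* (w :- v)) ≈-refl (v l) (w l)

normSq-self : ∀ {n} (v : Point n) → normSq (v -ᵖ v) ≈ 0ℝ
normSq-self {n} v = ≈-trans (sum-cong {n} λ l → solve 1 (λ v → (v :- v) :* (v :- v) := con 0ℚ) ≈-refl (v l))
  (≈-trans (sum-const n 0ℝ) (zeroʳ (fromℕ n)))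

δ-distance : ∀ {k} (i j : Fin k) → normSq (δ i -ᵖ δ j) ≈ 2ℝ - 2ℝ * δ i j
δ-distance {k} i j = ≈-trans
  (sum-cong λ l → solve 2 (λ a b → (a :- b) :* (a :- b)
      := (a :+ (:- con 1ℚ) :* b) :* (a :+ (:- con 1ℚ) :* b)) ≈-refl (δ i l) (δ j l))
  (≈-trans (∑diff i j (diff i j))
    (≈-trans (+-cong (+-cong (≡⇒≈ (δ-diag i)) (*-congˡ { - 1ℝ} (≡⇒≈ (δ-sym j i))))
                     (-‿cong (+-congˡ {δ i j} (*-congˡ { - 1ℝ} (≡⇒≈ (δ-diag j))))))
      (solve 1 (λ x → (con 1ℚ :+ (:- con 1ℚ) :* x) :- (x :+ (:- con 1ℚ) :* con 1ℚ) := :2 :- :2 :* x)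
        ≈-refl (δ i j))))

constant-δ-distance : ∀ {k} z (i : Fin k) → normSq ((λ _ → z) -ᵖ δ i) ≈ fromℕ k * z ² + (1ℝ - 2ℝ * z)
constant-δ-distance {k} z i = ≈-trans
  (sum-cong λ l → solve 2 (λ z x → (z :- x) :* (z :- x)
      := con 1ℚ :* (z :* z) :+ con 1ℚ :* (x :* (x :- :2 :* z))) ≈-refl z (δ i l))
  (≈-trans (sum-linear {k} 1ℝ 1ℝ (λ _ → z ²) (λ l → δ i l * (δ i l - 2ℝ * z)))
    (+-cong (≈-trans (*-identityˡ (∑[ l < k ] (z ²))) (sum-const k (z ²)))
      (≈-trans (*-identityˡ (∑[ l < k ] (δ i l * (δ i l - 2ℝ * z))))
        (≈-trans (∑δ i (λ l → δ i l - 2ℝ * z)) (+-congʳ { - (2ℝ * z)} (≡⇒≈ (δ-diag i)))))))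

-- The base consists of the unit vectors, in the hyperplane of coordinate sum 1; the apex has all
-- coordinates `z` and coordinate sum 1 - `ω`. Its squared height is `E` / d, positive by the last
-- hypothesis.
module ApexSimplex (m : ℕ) (u : ℝ) (0≤u : 0ℝ ≤ u) (2u<d+1 : 2ℝ * u < fromℕ (suc (suc m)) + 1ℝ) where

  d : ℕ
  d = suc (suc m)

  -- The coordinate z of the apex solves dz² - 2z + 1 = 2 - 2u/d, the squared distance to the base.
  dℝ ι E ω z : ℝ
  dℝ = fromℕ d
  ι  = 1/[1+ suc m ]
  E  = (dℝ + 1ℝ) - 2ℝ * u
  ω  = √ E
  z  = (1ℝ - ω) * ι

  dι≈1 : dℝ * ι ≈ 1ℝ
  dι≈1 = fromℕ-*-1/ (suc m)

  0<E : 0ℝ < E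
  0<E = <⇒0<- 2u<d+1

  ω²≈E : ω ² ≈ E
  ω²≈E = √-sq E (<⇒≤ 0<E)

  dz≈1-ω : dℝ * z ≈ 1ℝ - ω
  dz≈1-ω = ≈-trans (solve 3 (λ d w i → d :* ((con 1ℚ :- w) :* i) := (d :* i) :* (con 1ℚ :- w)) ≈-refl dℝ ω ι)
    (≈-trans (*-congʳ {1ℝ - ω} dι≈1) (*-identityˡ (1ℝ - ω)))

  vertex : Fin (suc d) → Point d
  vertex zero    _ = z
  vertex (suc i)   = δ i

  vertex-affinelyIndependent : AffinelyIndependent vertex
  vertex-affinelyIndependent c ∑c≈0 ∑cp≈0 = λ { zero → c₀≈0 ; (suc l) → ≈-trans (c-base l)
      (≈-trans (*-congʳ { - z} c₀≈0) (zeroˡ (- z))) }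
    where
    c₀ = c zero
    ∑cδ : ∀ l → ∑[ i < d ] (c (suc i) * δ i l) ≈ c (suc l)
    ∑cδ l = ≈-trans (sum-cong {d} λ i → ≈-trans (*-congˡ {c (suc i)} (≡⇒≈ (δ-sym i l)))
      (solve 2 (λ c x → c :* x := x :* c) ≈-refl (c (suc i)) (δ l i))) (∑δ l (c ∘ suc))
    c-base : ∀ l → c (suc l) ≈ c₀ * (- z)
    c-base l = ≈-trans (solve 3 (λ c z x → x := (c :* z :+ x) :+ c :* (:- z)) ≈-refl c₀ z (c (suc l)))
      (≈-trans (+-congʳ {c₀ * (- z)} (≈-trans (+-congˡ {c₀ * z} (≈-sym (∑cδ l))) (∑cp≈0 l)))
        (solve 1 (λ x → con 0ℚ :+ x := x) ≈-refl (c₀ * (- z))))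
    ωc₀≈0 : ω * c₀ ≈ 0ℝ
    ωc₀≈0 = ≈-trans (solve 2 (λ w c → w :* c := c :+ c :* (:- (con 1ℚ :- w))) ≈-refl ω c₀)
      (≈-trans (+-congˡ {c₀} (≈-trans (*-congˡ {c₀} (-‿cong (≈-sym dz≈1-ω)))
          (solve 3 (λ c d z → c :* (:- (d :* z)) := d :* (c :* (:- z))) ≈-refl c₀ dℝ z)))
        (≈-trans (+-congˡ {c₀} (≈-trans (≈-sym (sum-const d (c₀ * (- z)))) (sum-cong {d} λ l → ≈-sym (c-base l))))
          ∑c≈0))
    c₀≈0 : c₀ ≈ 0ℝ
    -- A second factor `ω` turns `ω` into `E`, which is known to be positive.
    c₀≈0 = *-pos-cancel-0 0<E (≈-trans (*-congʳ {c₀} (≈-sym ω²≈E))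
      (≈-trans (*-assoc ω ω c₀) (≈-trans (*-congˡ {ω} ωc₀≈0) (zeroʳ ω))))

  simplex : Simplex d
  simplex = record { vertex = vertex ; affinelyIndependent = vertex-affinelyIndependent }

  σ : ℝ
  σ = 2ℝ - 2ℝ * u * ι

  apex-distance : ∀ i → normSq (vertex zero -ᵖ vertex (suc i)) ≈ σ
  apex-distance i = ≈-trans (constant-δ-distance z i)
    (≈-trans (solve 3 (λ d w i → let z = (con 1ℚ :- w) :* i in
        d :* (z :* z) :+ (con 1ℚ :- :2 :* z)
          := (d :* i) :* (i :* ((con 1ℚ :- :2 :* w) :+ w :* w)) :+ (con 1ℚ :- :2 :* z)) ≈-refl dℝ ω ι)
      (≈-trans (+-congʳ {1ℝ - 2ℝ * z} (*-cong dι≈1 (*-congˡ {ι} (+-congˡ {1ℝ - 2ℝ * ω} ω²≈E))))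
        (≈-trans (solve 4 (λ d w i u →
            con 1ℚ :* (i :* ((con 1ℚ :- :2 :* w) :+ ((d :+ con 1ℚ) :- :2 :* u)))
              :+ (con 1ℚ :- :2 :* ((con 1ℚ :- w) :* i))
            := d :* i :+ (con 1ℚ :- :2 :* u :* i)) ≈-refl dℝ ω ι u)
          (≈-trans (+-congʳ {1ℝ - 2ℝ * u * ι} dι≈1)
            (solve 1 (λ x → con 1ℚ :+ (con 1ℚ :- x) := :2 :- x) ≈-refl (2ℝ * u * ι))))))

  0≤2 : 0ℝ ≤ 2ℝ
  0≤2 = 0≤fromℕ 2

  distance-≤2 : ∀ i j → normSq (vertex i -ᵖ vertex j) ≤ 2ℝ
  distance-≤2 zero    zero    = ≤-trans (≤-reflexive (normSq-self (vertex zero))) 0≤2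
  distance-≤2 zero    (suc j) = ≤-trans (≤-reflexive (apex-distance j))
    (by-nonneg (*-nonneg (*-nonneg 0≤2 0≤u) (<⇒≤ 0<1/[1+ suc m ]))
      (solve 1 (λ x → :2 :- (:2 :- x) := x) ≈-refl (2ℝ * u * ι)))
  distance-≤2 (suc i) zero    = ≤-trans (≤-reflexive (normSq-swap (vertex (suc i)) (vertex zero)))
    (distance-≤2 zero (suc i))
  distance-≤2 (suc i) (suc j) = ≤-trans (≤-reflexive (δ-distance i j))
    (by-nonneg (*-nonneg 0≤2 (δ-nonneg i j)) (solve 1 (λ x → :2 :- (:2 :- x) := x) ≈-refl (2ℝ * δ i j)))

  √2²≈2 : (√ 2ℝ) ² ≈ 2ℝ
  √2²≈2 = √-sq 2ℝ 0≤2

  isDiameter : IsDiameter (vertexSet simplex) (√ 2ℝ)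
  isDiameter =
    (λ { t (i , j , t≈) → ≤-trans (≤-reflexive t≈)
           (√-mono (normSq-nonneg (vertex i -ᵖ vertex j)) (distance-≤2 i j)) }) ,
    -- As d ≥ 2, the base has two vertices, and they attain the diameter.
    (λ b bound → bound (√ 2ℝ) (suc zero , suc (suc zero) ,
      √-cong 0≤2 (≈-sym (≈-trans (δ-distance {d} zero (suc zero))
        (solve 0 (:2 :- :2 :* con 0ℚ := :2) ≈-refl)))))

  inject-≢ : ∀ {k} (j : Fin k) (i : Fin (toℕ j)) → inject i ≢ j
  inject-≢ j i eq = ℕ.<⇒≢ (Fin.toℕ<n i) (≡.trans (≡.sym (Fin.toℕ-inject i)) (cong toℕ eq))

  deficit : Fin (suc d) → Fin (suc d) → ℝ
  deficit i j = (√ 2ℝ) ² - ‖ vertex i -ᵖ vertex j ‖ ²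

  deficit≈ : ∀ i j → deficit i j ≈ 2ℝ - normSq (vertex i -ᵖ vertex j)
  deficit≈ i j = +-cong √2²≈2 (-‿cong (‖‖²≈normSq (vertex i -ᵖ vertex j)))

  deficit-base : ∀ i j → i ≢ j → deficit (suc i) (suc j) ≈ 0ℝ
  deficit-base i j i≢j = ≈-trans (deficit≈ (suc i) (suc j))
    (≈-trans (+-congˡ {2ℝ} (-‿cong (≈-trans (δ-distance i j) (+-congˡ {2ℝ} (-‿cong (*-congˡ {2ℝ} (≡⇒≈ (δ-off i j i≢j))))))))
      (solve 0 (:2 :- (:2 :- :2 :* con 0ℚ) := con 0ℚ) ≈-refl))

  ∑-deficits : ∑-pairs (suc d) deficit ≈ 2ℝ * u
  -- The leading 0 is the empty column of the apex. In every other column only the pair with the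
  -- apex contributes, namely 2u/d.
  ∑-deficits = ≈-trans (solve 1 (λ x → con 0ℚ :+ x := x) ≈-refl (∑[ j < d ] column j))
    (≈-trans (sum-cong {d} column≈)
      (≈-trans (sum-const d (2ℝ * u * ι))
        (≈-trans (solve 3 (λ d u i → d :* (:2 :* u :* i) := (d :* i) :* (:2 :* u)) ≈-refl dℝ u ι)
          (≈-trans (*-congʳ {2ℝ * u} dι≈1) (*-identityˡ (2ℝ * u))))))
    where
    column : Fin d → ℝ
    column j = ∑[ i < suc (toℕ j) ] deficit (inject {i = suc j} i) (suc j)
    column≈ : ∀ j → column j ≈ 2ℝ * u * ι
    column≈ j = ≈-trans (+-cong (≈-trans (deficit≈ zero (suc j)) (+-congˡ {2ℝ} (-‿cong (apex-distance j))))
        (≈-trans (sum-cong {toℕ j} λ i → deficit-base (inject i) j (inject-≢ j i))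
          (≈-trans (sum-const (toℕ j) 0ℝ) (zeroʳ (fromℕ (toℕ j))))))
      (solve 1 (λ x → (:2 :- (:2 :- x)) :+ con 0ℚ := x) ≈-refl (2ℝ * u * ι))

  almostRegular : ∀ {ε} c → u /ℕ c ≤ ε → ∑-pairs (suc d) deficit /ℕ c ≤ ε * (√ 2ℝ) ²
  almostRegular {ε} c u/c≤ε = ≤-trans (≤-reflexive (mean c)) (≤-trans (*-monoˡ-≤-nonneg 0≤2 u/c≤ε)
    (≤-reflexive (≈-trans (solve 1 (λ e → :2 :* e := e :* :2) ≈-refl ε) (*-congˡ {ε} (≈-sym √2²≈2)))))
    where
    mean : ∀ c → ∑-pairs (suc d) deficit /ℕ c ≈ 2ℝ * (u /ℕ c)
    mean zero    = ≈-sym (zeroʳ 2ℝ)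
    mean (suc c) = ≈-trans (*-congʳ {1/[1+ c ]} ∑-deficits) (*-assoc 2ℝ u 1/[1+ c ])

-- Absence of monochromatic copies

²-mono-≤ : ∀ {x y} → 0ℝ ≤ x → x ≤ y → x ² ≤ y ²
²-mono-≤ {x} {y} 0≤x x≤y = by-nonneg (*-nonneg (≤⇒0≤- x≤y) (+-nonneg (≤-trans 0≤x x≤y) 0≤x))
  (solve 2 (λ x y → y :* y :- x :* x := (y :- x) :* (y :+ x)) ≈-refl x y)

normSq-translate : ∀ {n} (v w q : Point n) → normSq ((v -ᵖ q) -ᵖ (w -ᵖ q)) ≈ normSq (v -ᵖ w)
normSq-translate v w q = normSq-cong λ l →
  solve 3 (λ v w q → (v :- q) :- (w :- q) := v :- w) ≈-refl (v l) (w l) (q l)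

-- By weighted-distances-≤, a point at distance about ρ from all pᵢ satisfies
-- ∑∑ cᵢ cⱼ ‖pᵢ - pⱼ‖² ≲ 2 W² ρ².  The weights β (apex) and α are proportional to the barycentric
-- coordinates of the circumcentre, for which the left side is 2 W² R² with R² = α² / W > 1.
module NotRamsey (m : ℕ) (u : ℝ) (0≤u : 0ℝ ≤ u) (2u<d+1 : 2ℝ * u < fromℕ (suc (suc m)) + 1ℝ)
  (d<u² : fromℕ (suc (suc m)) < u ²) where

  open ApexSimplex m u 0≤u 2u<d+1

  α β W : ℝ
  α = dℝ - u
  β = dℝ * (1ℝ - u)
  W = dℝ * E

  0≤α : 0ℝ ≤ α
  -- 2α = `E` + (d - 1).
  0≤α = ≤-trans (*-nonneg (fromℚ-mono-≤ (ℚ.nonNegative⁻¹ ½)) (+-nonneg (<⇒≤ 0<E) (0≤fromℕ (suc m))))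
    (≤-reflexive (≈-trans (solve 3 (λ h d u → con ½ :* (((d :+ con 1ℚ) :- :2 :* u) :+ h)
        := con ½ :* (d :+ (h :+ con 1ℚ)) :- u) ≈-refl (fromℕ (suc m)) dℝ u)
      (≈-trans (+-congʳ { - u} (*-congˡ {fromℚ ½} (+-congˡ {dℝ} (≈-sym (fromℕ-suc (suc m))))))
        (solve 2 (λ d u → con ½ :* (d :+ d) :- u := d :- u) ≈-refl dℝ u))))

  0<W : 0ℝ < W
  0<W = *-positive (0<fromℕ-suc (suc m)) 0<E

  weight : Fin (suc d) → ℝ
  weight zero    = β
  weight (suc _) = α

  ∑weight : sum weight ≈ W
  ∑weight = ≈-trans (+-congˡ {β} (sum-const d α))
    (solve 2 (λ d u → d :* (con 1ℚ :- u) :+ d :* (d :- u) := d :* ((d :+ con 1ℚ) :- :2 :* u)) ≈-refl dℝ u)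

  dσ≈2α : dℝ * σ ≈ 2ℝ * α
  dσ≈2α = ≈-trans (solve 3 (λ d u i → d :* (:2 :- :2 :* u :* i)
      := :2 :* d :- (d :* i) :* (:2 :* u)) ≈-refl dℝ u ι)
    (≈-trans (+-congˡ {2ℝ * dℝ} (-‿cong (*-congʳ {2ℝ * u} dι≈1)))
      (solve 2 (λ d u → :2 :* d :- con 1ℚ :* (:2 :* u) := :2 :* (d :- u)) ≈-refl dℝ u))

  distSq : Fin (suc d) → Fin (suc d) → ℝ
  distSq i j = normSq (vertex i -ᵖ vertex j)

  row : Fin (suc d) → ℝ
  row i = ∑[ j < suc d ] (weight j * distSq i j)

  row-apex : row zero ≈ 2ℝ * α ²
  row-apex = ≈-trans (+-cong (*-congˡ {β} (normSq-self (vertex zero)))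
      (≈-trans (sum-cong {d} λ j → *-congˡ {α} (apex-distance j)) (sum-const d (α * σ))))
    (≈-trans (solve 4 (λ b d a s → b :* con 0ℚ :+ d :* (a :* s) := (d :* s) :* a) ≈-refl β dℝ α σ)
      (≈-trans (*-congʳ {α} dσ≈2α) (*-assoc 2ℝ α α)))

  -- By `dσ≈2α` this value is 2α (1 - u) + 2α (d - 1) = 2α², the same as for the apex. Equality of
  -- all rows is what singles out the weights of the circumcentre.
  row-base : ∀ i → row (suc i) ≈ β * σ + 2ℝ * α * (dℝ - 1ℝ)
  row-base i = +-cong (*-congˡ {β} (≈-trans (normSq-swap (vertex (suc i)) (vertex zero)) (apex-distance i)))
    (≈-trans (sum-cong {d} λ j → ≈-trans (*-congˡ {α} (δ-distance i j))
        (solve 2 (λ a x → a :* (:2 :- :2 :* x)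
          := (:2 :* a) :* con 1ℚ :+ (:- (:2 :* a)) :* (x :* con 1ℚ)) ≈-refl α (δ i j)))
      (≈-trans (sum-linear {d} (2ℝ * α) (- (2ℝ * α)) (λ _ → 1ℝ) (λ j → δ i j * 1ℝ))
        (≈-trans (+-cong (*-congˡ {2ℝ * α} (sum-const d 1ℝ)) (*-congˡ { - (2ℝ * α)} (∑δ i (λ _ → 1ℝ))))
          (solve 2 (λ a d → :2 :* a :* (d :* con 1ℚ) :+ (:- (:2 :* a)) :* con 1ℚ
            := :2 :* a :* (d :- con 1ℚ)) ≈-refl α dℝ))))

  weighted-distances : ∑[ i < suc d ] (weight i * row i) ≈ 2ℝ * W * α ²
  weighted-distances = ≈-trans (+-cong (*-congˡ {β} row-apex)
      (≈-trans (sum-cong {d} λ i → *-congˡ {α} (row-base i)) (sum-const d (α * (β * σ + 2ℝ * α * (dℝ - 1ℝ))))))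
    (≈-trans (solve 4 (λ b a d s → b :* (:2 :* (a :* a)) :+ d :* (a :* (b :* s :+ :2 :* a :* (d :- con 1ℚ)))
        := (d :* s) :* (a :* b) :+ (:2 :* (a :* a)) :* (b :+ d :* (d :- con 1ℚ))) ≈-refl β α dℝ σ)
      (≈-trans (+-congʳ {2ℝ * α ² * (β + dℝ * (dℝ - 1ℝ))} (*-congʳ {α * β} dσ≈2α))
        (solve 2 (λ d u → let a = d :- u ; b = d :* (con 1ℚ :- u) in
          (:2 :* a) :* (a :* b) :+ (:2 :* (a :* a)) :* (b :+ d :* (d :- con 1ℚ))
            := :2 :* (d :* ((d :+ con 1ℚ) :- :2 :* u)) :* (a :* a)) ≈-refl dℝ u)))

  slack : ℝ
  slack = 2ℝ * W + 2ℝ * dℝ * α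

  α²≈ : α ² ≈ W + (u ² - dℝ)
  α²≈ = solve 2 (λ d u → (d :- u) :* (d :- u) := d :* ((d :+ con 1ℚ) :- :2 :* u) :+ (u :* u :- d)) ≈-refl dℝ u

  -- After division by 2W, `upper` reads α² ≤ W + θ `slack`, whereas α² = W + (u² - d).
  no-thin-shell : ∀ {n θ} → 0ℝ < θ → θ * slack < u ² - dℝ → (v : Fin (suc d) → Point n) →
    (∀ i j → normSq (v i -ᵖ v j) ≈ distSq i j) →
    normSq (v zero) ≤ 1ℝ + θ + θ → (∀ i → normSq (v i) ≤ normSq (v zero) + (θ + θ)) → ⊥
  no-thin-shell {n} {θ} 0<θ θ-small v isometric apex≤ shell =
    ≤⇒≯ upper (by-pos (*-positive (*-positive (0<fromℕ-suc 1) 0<W) (<⇒0<- θ-small))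
      (≈-trans (+-congʳ { - (2ℝ * W * (W * (1ℝ + θ + θ) + dℝ * (α * (θ + θ))))} (*-congˡ {2ℝ * W} α²≈))
        (solve 5 (λ w a t k d → :2 :* w :* (w :+ k)
            :- :2 :* w :* (w :* (con 1ℚ :+ t :+ t) :+ d :* (a :* (t :+ t)))
          := :2 :* w :* (k :- t :* (:2 :* w :+ :2 :* d :* a))) ≈-refl W α θ (u ² - dℝ) dℝ)))
    where
    N₀ = normSq (v zero)
    0≤2W : 0ℝ ≤ 2ℝ * W
    0≤2W = *-nonneg 0≤2 (<⇒≤ 0<W)
    second-moment : ∑[ i < suc d ] (weight i * normSq (v i)) ≤ W * (1ℝ + θ + θ) + dℝ * (α * (θ + θ))
    -- The apex term, whose weight `β` is negative, is kept exact; the shell bound enters only with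
    -- the weight α ≥ 0. The total weight of `N₀` is then W > 0, so `apex≤` applies.
    second-moment = ≤-trans (+-mono-≤ ≤-refl (≤-trans
        (sum-mono-≤ {d} λ i → *-monoˡ-≤-nonneg 0≤α (shell (suc i))) (≤-reflexive (sum-const d (α * (N₀ + (θ + θ)))))))
      (≤-trans (≤-reflexive (≈-trans
          (solve 5 (λ b a d n t → b :* n :+ d :* (a :* (n :+ t))
            := (b :+ d :* a) :* n :+ d :* (a :* t)) ≈-refl β α dℝ N₀ (θ + θ))
          (+-congʳ {dℝ * (α * (θ + θ))} (*-congʳ {N₀} (≈-trans (+-congˡ {β} (≈-sym (sum-const d α))) ∑weight)))))
        (+-mono-≤ (*-monoˡ-≤-nonneg (<⇒≤ 0<W) apex≤) ≤-refl))
    upper : 2ℝ * W * α ² ≤ 2ℝ * W * (W * (1ℝ + θ + θ) + dℝ * (α * (θ + θ)))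
    upper = ≤-trans (≤-reflexive (≈-sym (≈-trans
        (sum-cong {suc d} λ i → *-congˡ {weight i} (sum-cong {suc d} λ j → *-congˡ {weight j} (isometric i j)))
        weighted-distances)))
      (≤-trans (Weighted.weighted-distances-≤ weight v)
        (≤-trans (≤-reflexive (*-congʳ {∑[ i < suc d ] (weight i * normSq (v i))} (*-congˡ {2ℝ} ∑weight)))
          (*-monoˡ-≤-nonneg 0≤2W second-moment)))

  congruent-normSq : ∀ {n} (B : FiniteSet n) ((f , _) : Congruent (vertexSet simplex) B) → ∀ i j →
    normSq (point B (Bijection.to f i) -ᵖ point B (Bijection.to f j)) ≈ distSq i j
  congruent-normSq B (f , isometric) i j = ≈-trans
    (≈-sym (‖‖²≈normSq (point B (Bijection.to f i) -ᵖ point B (Bijection.to f j))))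
    (≈-trans (≈-sym (*-cong (isometric i j) (isometric i j))) (‖‖²≈normSq (vertex i -ᵖ vertex j)))

  -- `D` is whatever real the Ramsey hypothesis provides; D ≤ √2 follows because √2 is an upper
  -- bound for the simplex and `D` is the least one.
  diameter⇒normSq-≤2 : ∀ {n D} (B : FiniteSet n) → IsDiameter (vertexSet simplex) D → IsDiameter B D →
    ∀ i j → normSq (point B i -ᵖ point B j) ≤ 2ℝ
  diameter⇒normSq-≤2 {D = D} B A-diam B-diam i j = ≤-trans (≤-reflexive (≈-sym (‖‖²≈normSq w)))
    (≤-trans (²-mono-≤ (√-nonneg (normSq w))
        (≤-trans (proj₁ B-diam ‖ w ‖ (i , j , ≈-refl)) (proj₂ A-diam (√ 2ℝ) (proj₁ isDiameter))))
      (≤-reflexive √2²≈2))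
    where w = point B i -ᵖ point B j

  notDiameterRamsey : ¬ DiameterRamsey (vertexSet simplex)
  notDiameterRamsey ramsey = contradiction
    where
    arch₁ = archimedean slack (<⇒0<- d<u²)
    arch₂ = archimedean 1ℝ (0<fromℕ-suc 0)
    N = proj₁ arch₁ ℕ.⊔ proj₁ arch₂
    θ = 1/[1+ N ]
    0<θ : 0ℝ < θ
    0<θ = 0<1/[1+ N ]
    θ-small : θ * slack < u ² - dℝ
    θ-small = proj₂ arch₁ N (ℕ.m≤m⊔n (proj₁ arch₁) (proj₁ arch₂))
    θ<1 : θ < 1ℝ
    θ<1 = ≤-<-trans (≤-reflexive (solve 1 (λ t → t := t :* con 1ℚ) ≈-refl θ))
      (proj₂ arch₂ N (ℕ.m≤n⊔m (proj₁ arch₁) (proj₁ arch₂)))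
    -- With θ = 1/(N + 1), the N + 3 colours `suc shells` reach exactly up to (N + 3)θ = 1 + 2θ.
    shells : ℕ
    shells = suc (suc N)
    1+2θ≤ : 1ℝ + θ + θ ≤ fromℕ (suc shells) * θ
    1+2θ≤ = ≤-reflexive (≈-trans (+-congʳ {θ} (+-congʳ {θ} (≈-sym (fromℕ-*-1/ N))))
      (≈-trans (solve 2 (λ k t → k :* t :+ t :+ t := (k :+ con 1ℚ :+ con 1ℚ) :* t) ≈-refl (fromℕ (suc N)) θ)
        (*-congʳ {θ} (≈-sym (≈-trans (fromℕ-suc shells) (+-congʳ {1ℝ} (fromℕ-suc (suc N))))))))
    refute-copy : ∀ {n k} (B : FiniteSet n) q (χ : Fin (size B) → Fin (suc shells)) →
      (∀ j → normSq (point B j -ᵖ q) ≤ 1ℝ + θ + θ) →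
      (∀ i j → χ i ≡ χ j → normSq (point B i -ᵖ q) ≤ normSq (point B j -ᵖ q) + (θ + θ)) →
      (g : Fin k ↣ Fin (size B)) → (∀ i j → χ (Injection.to g i) ≡ χ (Injection.to g j)) →
      Congruent (vertexSet simplex) (subset B g) → ⊥
    refute-copy B q χ near same g mono congruent@(f , _) = no-thin-shell 0<θ θ-small
      (λ i → point B (index i) -ᵖ q)
      (λ i j → ≈-trans (normSq-translate (point B (index i)) (point B (index j)) q)
        (congruent-normSq (subset B g) congruent i j))
      (near (index zero))
      (λ i → same (index i) (index zero) (mono (Bijection.to f i) (Bijection.to f zero)))
      where
      index : Fin (suc d) → Fin (size B)
      index i = Injection.to g (Bijection.to f i)
    refute-colouring : ∀ {n} (B : FiniteSet n) q → (∀ j → normSq (point B j -ᵖ q) ≤ 1ℝ + θ + θ) →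
      Σ[ χ ∈ (Fin (size B) → Fin (suc shells)) ]
        (∀ i j → χ i ≡ χ j → normSq (point B i -ᵖ q) ≤ normSq (point B j -ᵖ q) + (θ + θ)) →
      (∀ (χ : Fin (size B) → Fin (suc shells)) → ∃[ k ] Σ[ g ∈ Fin k ↣ Fin (size B) ]
        (∀ i j → χ (Injection.to g i) ≡ χ (Injection.to g j)) × Congruent (vertexSet simplex) (subset B g)) → ⊥
    refute-colouring B q near (χ , same) monochromatic =
      let k , g , mono , congruent = monochromatic χ in refute-copy B q χ near same g mono congruent
    contradiction : ⊥
    contradiction =
      let n , _ , B , (D , A-diam , B-diam) , monochromatic = ramsey (suc shells) (ℕ.s≤s ℕ.z≤n)
          q , near = approximate-jung (point B) (diameter⇒normSq-≤2 B A-diam B-diam) 0<θ θ<1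
      in refute-colouring B q near
           (Shells.shell-colouring 0<θ shells (λ i → normSq (point B i -ᵖ q))
             (λ i → normSq-nonneg (point B i -ᵖ q)) (λ i → ≤-trans (near i) 1+2θ≤))
           monochromatic

-- The choice of the apex height

1/[1+_]≤1 : ∀ n → 1/[1+ n ] ≤ 1ℝ
1/[1+ n ]≤1 = by-nonneg (*-nonneg (0≤fromℕ n) (<⇒≤ 0<1/[1+ n ]))
  (≈-trans (+-congʳ { - 1/[1+ n ]} (≈-sym (fromℕ-*-1/ n)))
    (≈-trans (+-congʳ { - 1/[1+ n ]} (*-congʳ {1/[1+ n ]} (fromℕ-suc n)))
    (solve 2 (λ k t → (k :+ con 1ℚ) :* t :- t := k :* t) ≈-refl (fromℕ n) 1/[1+ n ])))

common-gap : ∀ {p q} → 0ℚ ℚ.< p → 0ℚ ℚ.< q → Σ[ x ∈ ℝ ] (0ℝ < x × x ≤ fromℚ p × x ≤ fromℚ q)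
common-gap {p} {q} 0<p 0<q = choose (ℚ.≤-total p q)
  where
  choose : p ℚ.≤ q ⊎ q ℚ.≤ p → Σ[ x ∈ ℝ ] (0ℝ < x × x ≤ fromℚ p × x ≤ fromℚ q)
  choose (inj₁ p≤q) = fromℚ p , fromℚ-mono-< 0<p , ≤-refl , fromℚ-mono-≤ p≤q
  choose (inj₂ q≤p) = fromℚ q , fromℚ-mono-< 0<q , fromℚ-mono-≤ q≤p , ≤-refl

-- Dividing by c ≥ 1 does not enlarge μ, so any μ within the gap will do. As `c` is arbitrary here,
-- the junk quotient at c = 0 is a case of its own.
/ℕ-perturb : ∀ {x ε p} c → x /ℕ c < ε → 0ℚ ℚ.< p → Σ[ μ ∈ ℝ ] (0ℝ < μ × μ ≤ fromℚ p × (x + μ) /ℕ c ≤ ε)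
/ℕ-perturb {p = p} zero 0<ε 0<p = fromℚ p , fromℚ-mono-< 0<p , ≤-refl , <⇒≤ 0<ε
/ℕ-perturb {x} {ε} {p} (suc c) x/c<ε 0<p =
  let g , 0<g , x/c+g≤ε  = <⇒rational-gap x/c<ε
      μ , 0<μ , μ≤g , μ≤p = common-gap 0<g 0<p
  in μ , 0<μ , μ≤p , by-nonneg
       (+-nonneg (+-nonneg (≤⇒0≤- x/c+g≤ε) (≤⇒0≤- μ≤g)) (*-nonneg (<⇒≤ 0<μ) (≤⇒0≤- 1/[1+ c ]≤1)))
       (solve 5 (λ e x m g t → e :- (x :+ m) :* t := ((e :- (x :* t :+ g)) :+ (g :- m)) :+ m :* (con 1ℚ :- t))
         ≈-refl ε x μ (fromℚ g) 1/[1+ c ])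

-- At u = √d the squared height of the apex is (√d - 1)² / d, which is positive for d ≥ 2 and leaves
-- room to enlarge u. For d = 1 it vanishes, and indeed every two-point set is diameter-Ramsey, by
-- the pigeonhole principle on a regular simplex.
corollary1p4 : ∀ (d : ℕ) → 2 ℕ.≤ d → ∀ (ε : ℝ) → (√ (fromℕ d)) /ℕ (suc d C 2) < ε →
    Σ[ A ∈ Simplex d ] (AlmostRegular ε A × ¬ DiameterRamsey (vertexSet A))
corollary1p4 d@(suc (suc m)) (ℕ.s≤s (ℕ.s≤s ℕ.z≤n)) ε √d/C<ε =
  let μ , 0<μ , μ≤1/64 , u/C≤ε = /ℕ-perturb (suc d C 2) √d/C<ε (ℚ.positive⁻¹ (+ 1 / 64))
      0≤μ   = <⇒≤ 0<μ
      S     = √ (fromℕ d)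
      0≤S   = √-nonneg (fromℕ d)
      S²≈d  = √-sq (fromℕ d) (0≤fromℕ d)
      0≤S-5/4 = ≤⇒0≤- (²-cancel-≤ {fromℚ (+ 5 / 4)} 0≤S (≤-trans
        (pointwise-≤ {fromℚ (+ 5 / 4) ²} {2ℝ} λ _ → ℚ.*≤* (ℤ.+≤+ (ℕ.m≤m+n 25 7)))
        (≤-trans (fromℕ-mono-≤ (ℕ.s≤s (ℕ.s≤s (ℕ.z≤n {m})))) (≤-reflexive (≈-sym S²≈d)))))
      u     = S + μ
      0≤u   = +-nonneg 0≤S 0≤μ
      -- The difference is (S - 1)² - 2μ. From S ≥ 5/4, a rational lower bound for √2, and μ ≤ 1/64
      -- it is at least 1/16 - 1/32.
      2u<d+1 : 2ℝ * u < fromℕ d + 1ℝ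
      2u<d+1 = by-pos
        (+-pos (fromℚ-mono-< {0ℚ} {+ 1 / 32} (ℚ.positive⁻¹ (+ 1 / 32)))
          (+-nonneg (x²-nonneg (S - fromℚ (+ 5 / 4)))
            (+-nonneg (*-nonneg (0≤fromℚ ½) 0≤S-5/4) (*-nonneg (0≤fromℕ 2) (≤⇒0≤- μ≤1/64)))))
        (≈-trans (+-congʳ { - (2ℝ * u)} (+-congʳ {1ℝ} (≈-sym S²≈d)))
          (solve 2 (λ s m → (s :* s :+ con 1ℚ) :- :2 :* (s :+ m)
            := con (+ 1 / 32) :+ ((s :- con (+ 5 / 4)) :* (s :- con (+ 5 / 4))
               :+ (con ½ :* (s :- con (+ 5 / 4)) :+ :2 :* (con (+ 1 / 64) :- m)))) ≈-refl S μ))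
      d<u² : fromℕ d < u ²
      d<u² = by-pos (+-pos (*-positive 0<μ 0<μ) (*-nonneg (0≤fromℕ 2) (*-nonneg 0≤μ 0≤S)))
        (≈-trans (+-congˡ {u ²} (-‿cong (≈-sym S²≈d)))
          (solve 2 (λ s m → (s :+ m) :* (s :+ m) :- s :* s := m :* m :+ :2 :* (m :* s)) ≈-refl S μ))
      open ApexSimplex m u 0≤u 2u<d+1 using (simplex; isDiameter; almostRegular)
  in simplex , (√ 2ℝ , isDiameter , almostRegular (suc d C 2) u/C≤ε) ,
     NotRamsey.notDiameterRamsey m u 0≤u 2u<d+1 d<u²
  where
  0≤fromℚ : ∀ p {{_ : ℚ.NonNegative p}} → 0ℝ ≤ fromℚ p
  0≤fromℚ p = fromℚ-mono-≤ (ℚ.nonNegative⁻¹ p)
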